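{- Let $D$ be a finite set, let $M\in\{0,1,*\}^{D\times D}$ be a symmetric matrix and let $C\colon D\to\mathbb{Z}_{\geq 0}$ be a function. Then the problem #$C$-$M$-partitions is polynomial-time Turing reducible to the problem #List-$M$-partitions.
   Context: For a symmetric matrix $M\in\{0,1,*\}^{D\times D}$ and an undirected graph $G=(V,E)$ (no loops), an $M$-partition of $G$ is a function $\sigma\colon V\to D$ such that, for all distinct $u,v\in V$: $M_{\sigma(u),\sigma(v)}\neq 0$ if $(u,v)\in E$, and $M_{\sigma(u),\sigma(v)}\neq 1$ if $(u,v)\notin E$. Let $\mathcal{P}(D)$ be the powerset of $D$. Given $L\colon V(G)\to\mathcal{P}(D)$, $\sigma$ respects $L$ if $\sigma(v)\in L(v)$ for all $v\in V(G)$. Problem #List-$M$-partitions ($M$ fixed). Input: a pair $(G,L)$ where $G$ is a graph and $L\colon V(G)\to\mathcal{P}(D)$. Output: the number of $M$-partitions of $G$ that respect $L$. A cardinality constraint is a function $C\colon D\to\mathbb{Z}_{\geq 0}$. An $M$-partition $\sigma$ of $G$ satisfies $C$ if $|\{v\in V(G)\mid\sigma(v)=d\}|\geq C(d)$ for each $d\in D$. Problem #$C$-$M$-partitions ($C$ and $M$ fixed parameters, not part of the input). Input: a graph $G$. Output: the number of $M$-partitions of $G$ that satisfy $C$. A counting problem $P$ is polynomial-time Turing reducible to a counting problem $Q$ if there is a polynomial-time deterministic oracle Turing machine that, on every instance $x$ of $P$, outputs $P(x)$ by making queries to an oracle for $Q$. -}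

module Defs where

open import Data.Bool.Base using (Bool; true; false; T)
open import Data.Bool.Properties using (T?)
open import Data.Fin.Base using (Fin; zero; suc)
open import Data.Fin.Properties using (all?) renaming (_≟_ to _≟ᶠ_)
open import Data.Fin.Subset using (Subset; _∈_)
open import Data.Fin.Subset.Properties using (_∈?_)
open import Data.List.Base as List using (List; []; _∷_; _++_)
open import Data.List.Properties as List using (++-assoc)
open import Data.Maybe.Base using (Maybe; nothing; just)
open import Data.Nat.Base using (ℕ; zero; suc; _+_; _*_; _^_; _≤_; _≥_)
open import Data.Nat.Properties using (_≥?_)
open import Data.Product.Base using (Σ; Σ-syntax; ∃-syntax; _×_; _,_)
open import Data.Vec.Base as Vec using (Vec; []; _∷_; lookup; toList)
open import Data.Vec.Properties as Vec using (toList-++)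
open import Function.Bundles using (_↔_)
open import Relation.Binary.PropositionalEquality
  using (_≡_; _≢_; refl; sym; trans; cong₂)
open import Relation.Nullary using (¬_; Dec; yes; no; ¬?; _→-dec_; _×-dec_)
open import Relation.Unary using (Decidable)

Word : Set
Word = List Bool

increment : Word → Word
increment []           = true ∷ []
increment (false ∷ bs) = true ∷ bs
increment (true  ∷ bs) = false ∷ increment bs

-- Least significant bit first, without leading zeros; 0 is the empty word.
binary : ℕ → Word
binary zero    = []
binary (suc n) = increment (binary n)

Finite : Set → Set
Finite A = Σ[ n ∈ ℕ ] A ↔ Fin n

data Symbol (Aux : Set) : Set where
  blank : Symbol Aux
  bit   : Bool → Symbol Aux
  aux   : Aux → Symbol Aux

-- A two-way infinite tape.  `left` lists the cells to the left of the
-- head, nearest first; all cells not listed are blank.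
record Tape (Aux : Set) : Set where
  constructor tape
  field
    left  : List (Symbol Aux)
    head  : Symbol Aux
    right : List (Symbol Aux)

data Direction : Set where
  ◁ ∙ ▷ : Direction

module _ {Aux : Set} where

  load : Word → Tape Aux
  load []       = tape [] blank []
  load (b ∷ bs) = tape [] (bit b) (List.map bit bs)

  leadingBits : List (Symbol Aux) → Word
  leadingBits (bit b ∷ xs) = b ∷ leadingBits xs
  leadingBits _            = []

  -- The word on a tape extends from the head to the right, up to the
  -- first cell that does not hold a bit.
  contents : Tape Aux → Word
  contents (tape _ h r) = leadingBits (h ∷ r)

  shift : Direction → Tape Aux → Tape Aux
  shift ◁ (tape []      h r)       = tape [] blank (h ∷ r)
  shift ◁ (tape (x ∷ l) h r)       = tape l x (h ∷ r)
  shift ∙ τ                        = τ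
  shift ▷ (tape l       h [])      = tape (h ∷ l) blank []
  shift ▷ (tape l       h (x ∷ r)) = tape (h ∷ l) x r

  write : Symbol Aux → Tape Aux → Tape Aux
  write x (tape l _ r) = tape l x r

  writeAndShift : Symbol Aux × Direction → Tape Aux → Tape Aux
  writeAndShift (x , d) τ = shift d (write x τ)

data Action (State Aux : Set) (tapes : ℕ) : Set where
  halt : Action State Aux tapes
  move : State → Vec (Symbol Aux × Direction) tapes → Action State Aux tapes
  ask  : State → Action State Aux tapes

-- Tape 0 holds the input, tape 1 is the oracle tape and tape 2 the output
-- tape; the remaining tapes are work tapes.
record OracleMachine : Set₁ where
  field
    State        : Set
    Aux          : Set
    state-finite : Finite State
    aux-finite   : Finite Aux
    workTapes    : ℕ
    start        : State

  tapes : ℕ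
  tapes = 3 + workTapes

  field
    δ : State → Vec (Symbol Aux) tapes → Action State Aux tapes

module Run (𝓜 : OracleMachine) (oracle : Word → Word) where
  open OracleMachine 𝓜

  record Config : Set where
    constructor config
    field
      state : State
      tape⃗  : Vec (Tape Aux) tapes

  initial : Word → Config
  initial w = config start (load w ∷ Vec.replicate (2 + workTapes) (load []))

  output : Config → Word
  output (config _ τ) = contents (lookup τ (suc (suc zero)))

  -- A query takes one step and replaces the whole oracle tape, carrying a
  -- word w, by a tape carrying oracle w.
  perform : Action State Aux tapes → Vec (Tape Aux) tapes → Maybe Config
  perform halt          τ = nothing
  perform (move q acts) τ = just (config q (Vec.zipWith writeAndShift acts τ))
  perform (ask q)       τ =
    just (config q (Vec.updateAt τ (suc zero) (λ t → load (oracle (contents t)))))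

  step : Config → Maybe Config
  step (config q τ) = perform (δ q (Vec.map Tape.head τ)) τ

  infix 4 _⇓⟨_⟩_

  -- c ⇓⟨ t ⟩ w : from c, the machine halts after exactly t steps with output w.
  data _⇓⟨_⟩_ : Config → ℕ → Word → Set where
    stop : ∀ {c} → step c ≡ nothing → c ⇓⟨ 0 ⟩ output c
    next : ∀ {c c′ t w} → step c ≡ just c′ → c′ ⇓⟨ t ⟩ w → c ⇓⟨ suc t ⟩ w

record CountingProblem : Set₁ where
  field
    Instance         : Set
    encode           : Instance → Word
    encode-injective : ∀ {x y} → encode x ≡ encode y → x ≡ y
    value            : Instance → ℕ

-- The answers to words that encode no instance are arbitrary.
_IsOracleFor_ : (Word → Word) → CountingProblem → Set
oracle IsOracleFor Q = ∀ y → oracle (encode y) ≡ binary (value y)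
  where open CountingProblem Q

infix 4 _≤ᵀ_

_≤ᵀ_ : CountingProblem → CountingProblem → Set₁
P ≤ᵀ Q =
  Σ[ 𝓜 ∈ OracleMachine ] ∃[ c ] ∃[ e ]
    (∀ (oracle : Word → Word) → oracle IsOracleFor Q → ∀ (x : Instance) →
      let open Run 𝓜 oracle in
      ∃[ t ] t ≤ c * List.length (encode x) ^ e + c
           × initial (encode x) ⇓⟨ t ⟩ binary (value x))
  where open CountingProblem P

-- The vertex set is Fin order.
record Graph : Set where
  constructor graph
  field
    order      : ℕ
    adjacency  : Vec (Vec Bool order) order

  Adjacent : Fin order → Fin order → Set
  Adjacent u v = T (lookup (lookup adjacency u) v)

  field
    .symmetric   : ∀ u v → Adjacent u v → Adjacent v u
    .irreflexive : ∀ v → ¬ Adjacent v v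

  adjacent? : ∀ u v → Dec (Adjacent u v)
  adjacent? u v = T? (lookup (lookup adjacency u) v)

open Graph using (order)

data Entry : Set where
  𝟎 𝟏 ⋆ : Entry

_≟_ : (a b : Entry) → Dec (a ≡ b)
𝟎 ≟ 𝟎 = yes refl
𝟎 ≟ 𝟏 = no λ ()
𝟎 ≟ ⋆ = no λ ()
𝟏 ≟ 𝟎 = no λ ()
𝟏 ≟ 𝟏 = yes refl
𝟏 ≟ ⋆ = no λ ()
⋆ ≟ 𝟎 = no λ ()
⋆ ≟ 𝟏 = no λ ()
⋆ ≟ ⋆ = yes refl

Matrix : ℕ → Set
Matrix k = Fin k → Fin k → Entry

SymmetricMatrix : ∀ {k} → Matrix k → Set
SymmetricMatrix M = ∀ i j → M i j ≡ M j i

-- The set D is Fin k.  The vector σ represents the function v ↦ lookup σ v.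
module _ {k : ℕ} where

  IsPartition : Matrix k → (G : Graph) → Vec (Fin k) (order G) → Set
  IsPartition M G σ = ∀ u v → u ≢ v →
      (Adjacent u v → M (lookup σ u) (lookup σ v) ≢ 𝟎)
    × (¬ Adjacent u v → M (lookup σ u) (lookup σ v) ≢ 𝟏)
    where open Graph G

  isPartition? : ∀ M G → Decidable (IsPartition M G)
  isPartition? M G σ = all? λ u → all? λ v → ¬? (u ≟ᶠ v) →-dec
      ((adjacent? u v →-dec ¬? (M (lookup σ u) (lookup σ v) ≟ 𝟎))
    ×-dec (¬? (adjacent? u v) →-dec ¬? (M (lookup σ u) (lookup σ v) ≟ 𝟏)))
    where open Graph G

  Respects : ∀ {n} → Vec (Subset k) n → Vec (Fin k) n → Set
  Respects L σ = ∀ v → lookup σ v ∈ lookup L v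

  respects? : ∀ {n} (L : Vec (Subset k) n) → Decidable (Respects L)
  respects? L σ = all? λ v → lookup σ v ∈? lookup L v

  Satisfies : ∀ {n} → (Fin k → ℕ) → Vec (Fin k) n → Set
  Satisfies C σ = ∀ d → Vec.count (_≟ᶠ d) σ ≥ C d

  satisfies? : ∀ {n} (C : Fin k → ℕ) → Decidable (Satisfies {n} C)
  satisfies? C σ = all? λ d → Vec.count (_≟ᶠ d) σ ≥? C d

-- Every vector occurs in this list exactly once.
assignments : ∀ k n → List (Vec (Fin k) n)
assignments k zero    = [] ∷ []
assignments k (suc n) = List.cartesianProductWith _∷_ (List.allFin k) (assignments k n)

numberOf : ∀ {k n} {P : Vec (Fin k) n → Set} → Decidable P → ℕ
numberOf {k} {n} P? = List.length (List.filter P? (assignments k n))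

flatten : ∀ {m n} → Vec (Vec Bool n) m → Word
flatten xss = toList (Vec.concat xss)

-- The number of vertices in unary, then the adjacency matrix row by row.
encodeGraph : Graph → Word
encodeGraph G = List.replicate (order G) true ++ false ∷ flatten (Graph.adjacency G)

ListInstance : ℕ → Set
ListInstance k = Σ[ G ∈ Graph ] Vec (Subset k) (order G)

-- Each list is given by its characteristic vector of length k.
encodeListInstance : ∀ {k} → ListInstance k → Word
encodeListInstance (G , L) = encodeGraph G ++ flatten L

unary-injective : ∀ m n {xs ys : Word} →
  List.replicate m true ++ false ∷ xs ≡ List.replicate n true ++ false ∷ ys →
  m ≡ n × xs ≡ ys
unary-injective zero    zero    refl = refl , refl
unary-injective (suc m) (suc n) eq
  with refl , xs≡ys ← unary-injective m n (List.∷-injectiveʳ eq) = refl , xs≡ys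

toList-injective : ∀ {A : Set} {n} (xs ys : Vec A n) → toList xs ≡ toList ys → xs ≡ ys
toList-injective []       []       _  = refl
toList-injective (x ∷ xs) (y ∷ ys) eq =
  cong₂ _∷_ (List.∷-injectiveˡ eq) (toList-injective xs ys (List.∷-injectiveʳ eq))

concat-injective : ∀ {A : Set} {m n} (xss yss : Vec (Vec A n) m) →
  Vec.concat xss ≡ Vec.concat yss → xss ≡ yss
concat-injective []         []         _  = refl
concat-injective (xs ∷ xss) (ys ∷ yss) eq
  with xs≡ys , eq′ ← Vec.++-injective xs ys eq =
  cong₂ _∷_ xs≡ys (concat-injective xss yss eq′)

flatten-injective : ∀ {m n} (xss yss : Vec (Vec Bool n) m) →
  flatten xss ≡ flatten yss → xss ≡ yss
flatten-injective xss yss eq = concat-injective xss yss (toList-injective _ _ eq)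

encodeGraph-injective : ∀ {G H} → encodeGraph G ≡ encodeGraph H → G ≡ H
encodeGraph-injective {graph m A _ _} {graph n B _ _} eq
  with refl , eq′ ← unary-injective m n eq
  with refl ← flatten-injective A B eq′ = refl

encodeListInstance-injective : ∀ {k} {x y : ListInstance k} →
  encodeListInstance x ≡ encodeListInstance y → x ≡ y
encodeListInstance-injective {x = graph m A _ _ , K} {graph n B _ _ , L} eq
  with refl , eq′ ← unary-injective m n
         (trans (sym (++-assoc (List.replicate m true) _ _))
           (trans eq (++-assoc (List.replicate n true) _ _)))
  with A≡B , K≡L ← Vec.++-injective (Vec.concat A) (Vec.concat B)
         (toList-injective _ _
           (trans (toList-++ (Vec.concat A) (Vec.concat K))
             (trans eq′ (sym (toList-++ (Vec.concat B) (Vec.concat L))))))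
  with refl ← concat-injective A B A≡B
  with refl ← concat-injective K L K≡L = refl

#List-_-partitions : ∀ {k} → Matrix k → CountingProblem
#List-_-partitions {k} M = record
  { Instance         = ListInstance k
  ; encode           = encodeListInstance
  ; encode-injective = encodeListInstance-injective
  ; value            = λ (G , L) →
      numberOf (λ σ → isPartition? M G σ ×-dec respects? L σ)
  }

#_-_-partitions : ∀ {k} → (Fin k → ℕ) → Matrix k → CountingProblem
#_-_-partitions C M = record
  { Instance         = Graph
  ; encode           = encodeGraph
  ; encode-injective = encodeGraph-injective
  ; value            = λ G →
      numberOf (λ σ → isPartition? M G σ ×-dec satisfies? C σ)
  }

{-# OPTIONS --safe #-}

module Submission where

-- Every partition σ that satisfies C is determined by σ together with, for
-- each class d, the set of its last C d vertices.  Reading the vertices from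
-- last to first, each vertex is either one of these ("taken" for some d, list
-- {d}) or "free", and then only the classes whose requirement is already met
-- are allowed.  So the number sought is a sum, without cancellation, of the
-- answers to list instances, one for each sequence of decisions that takes
-- C d vertices for each d.  There are at most polynomially many such
-- sequences, since only Σ C vertices are taken; the machine runs through them
-- by backtracking and adds up the answers in binary.

open import Data.Bool.Base using (Bool; true; false; if_then_else_; _xor_)
open import Data.Empty using (⊥-elim)
open import Data.Fin.Base as Fin using (Fin; zero; suc; toℕ; fromℕ<; finToFun; funToFin)
open import Data.Fin.Patterns
open import Data.Fin.Properties as Fin
  using (1↔⊤; 2↔Bool; +↔⊎; *↔×; all?; finToFun-funToFin; toℕ-fromℕ<; toℕ-inject₁)
  renaming (_≟_ to _≟ᶠ_)
open import Data.Fin.Subset using (Subset; _∈_; _∉_; ⁅_⁆)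
open import Data.Fin.Subset.Properties using (_∈?_; x∈⁅x⁆; x∈⁅y⁆⇒x≡y)
open import Data.List.Base as List
  using (List; []; _∷_; [_]; _++_; _ʳ++_; length; map; replicate; concatMap; reverse;
         tabulate; filter)
open import Data.List.Properties as List using ()
open import Data.List.Relation.Unary.All as All using (All; []; _∷_)
open import Data.List.Relation.Unary.All.Properties as All using ()
open import Data.Maybe.Base as Maybe using (Maybe; nothing; just)
open import Data.Maybe.Relation.Binary.Pointwise as MaybePointwise using ()
open import Data.Nat.Base
open import Data.Nat.ListAction using (sum)
open import Data.Nat.Properties
open import Data.Nat.Tactic.RingSolver using (solve-∀)
open import Data.Product.Base using (_×_; _,_; proj₁; proj₂; ∃-syntax; -,_)
open import Data.Product.Function.NonDependent.Propositional using (_×-↔_)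
open import Data.Sum.Base using (_⊎_; inj₁; inj₂)
open import Data.Sum.Function.Propositional using (_⊎-↔_)
open import Data.Unit.Base using (⊤; tt)
open import Data.Vec.Base as Vec using (Vec; []; _∷_; lookup; toList)
open import Data.Vec.Properties as Vec
  using (lookup∘tabulate; []=⇒lookup; lookup⇒[]=; toList-++)
open import Data.Vec.Relation.Binary.Pointwise.Inductive using (Pointwise; []; _∷_)
open import Function.Base using (_∘_; id)
open import Function.Bundles using (_↔_; mk↔ₛ′; _⇔_; mk⇔)
open import Function.Properties.Inverse using (↔-sym; ↔-trans)
open import Relation.Binary.PropositionalEquality hiding ([_])
open import Relation.Nullary using (¬_; Dec; yes; no; does; _×-dec_)
open import Relation.Nullary.Decidable using (dec-true; dec-false; does-⇔)
open import Relation.Unary using (Decidable)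
open import Defs hiding (_≟_)

-- Fixing the last `C d` vertices of each class, rather than any `C d` of them, makes the decisions
-- a function of σ; barring free vertices from classes with unmet requirement enforces this choice,
-- so no partition is counted twice. As every term is nonnegative, each partial sum is at most the
-- final value, which bounds the length of the accumulator at all times. The vertices are read
-- backwards because the latest decision lies on top of the stack: at a leaf the stack, read from
-- its top, spells the lists in the order of the vertices, and a query is a copy of the input
-- followed by that word. The unmet requirements range over a finite set fixed by `C`, so states and
-- stack symbols can hold them. The only unbounded quantity besides the stack and the accumulator is
-- the depth, and the unary block of the input serves as its counter.

-- Binary addition and the length of binary numerals

sumBit carryBit : Bool → Bool → Bool → Bool
sumBit   c a b = c xor (a xor b)
carryBit c a b = if a xor b then c else a

-- These are the digits that the machine writes in the states `adding c`. A missing digit counts as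
-- 0, and the recursion ends only when both words and the carry are exhausted, so summands without
-- leading zeros give a sum without leading zeros.
add : Bool → Word → Word → Word
add false []      []      = []
add true  []      []      = true ∷ []
add c     []      (b ∷ v) = sumBit c false b ∷ add (carryBit c false b) [] v
add c     (a ∷ u) []      = sumBit c a false ∷ add (carryBit c a false) u []
add c     (a ∷ u) (b ∷ v) = sumBit c a b ∷ add (carryBit c a b) u v

-- A carry into the lowest place is one more unit. `add-increment` needs this whenever the second
-- word begins with a 1.
add-true : ∀ u v → add true u v ≡ increment (add false u v)
add-true []          []          = refl
add-true []          (false ∷ v) = refl
add-true []          (true ∷ v)  = cong (false ∷_) (add-true [] v)
add-true (false ∷ u) []          = refl
add-true (true ∷ u)  []          = cong (false ∷_) (add-true u [])
add-true (false ∷ u) (false ∷ v) = refl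
add-true (false ∷ u) (true ∷ v)  = cong (false ∷_) (add-true u v)
add-true (true ∷ u)  (false ∷ v) = cong (false ∷_) (add-true u v)
add-true (true ∷ u)  (true ∷ v)  = refl

add-[] : ∀ v → add false [] v ≡ v
add-[] []          = refl
add-[] (false ∷ v) = cong (false ∷_) (add-[] v)
add-[] (true ∷ v)  = cong (true ∷_) (add-[] v)

add-increment : ∀ u v → add false (increment u) v ≡ increment (add false u v)
add-increment []          []          = refl
add-increment []          (false ∷ v) = refl
add-increment []          (true ∷ v)  = cong (false ∷_) (add-true [] v)
add-increment (false ∷ u) []          = refl
add-increment (true ∷ u)  []          = cong (false ∷_) (add-increment u [])
add-increment (false ∷ u) (false ∷ v) = refl
add-increment (false ∷ u) (true ∷ v)  = cong (false ∷_) (add-true u v)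
add-increment (true ∷ u)  (false ∷ v) = cong (false ∷_) (add-increment u v)
add-increment (true ∷ u)  (true ∷ v)  =
  cong (true ∷_) (trans (add-increment u v) (sym (add-true u v)))

add-binary : ∀ m n → add false (binary m) (binary n) ≡ binary (m + n)
add-binary zero    n = add-[] (binary n)
add-binary (suc m) n =
  trans (add-increment (binary m) (binary n)) (cong increment (add-binary m n))

binary-odd : ∀ n → binary (suc (n + n)) ≡ true ∷ binary n
binary-odd zero    = refl
binary-odd (suc n)
  rewrite +-suc n n = cong (increment ∘ increment) (binary-odd n)

binary-even : ∀ n → binary (suc n + suc n) ≡ false ∷ binary (suc n)
binary-even n rewrite +-suc n n = cong increment (binary-odd n)

data Halves : ℕ → Set where
  even : ∀ n → Halves (n + n)
  odd  : ∀ n → Halves (suc (n + n))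

halves : ∀ n → Halves n
halves zero = even 0
halves (suc n) with halves n
... | even m = odd m
... | odd  m = subst Halves (cong suc (+-suc m m)) (even (suc m))

double-<⁻¹ : ∀ {m n} → m + m < n + n → m < n
double-<⁻¹ {m} {n} lt with m <? n
... | yes m<n = m<n
... | no  m≮n = ⊥-elim (<⇒≱ lt (+-mono-≤ (≮⇒≥ m≮n) (≮⇒≥ m≮n)))

length-binary : ∀ b n → n < 2 ^ b → length (binary n) ≤ b
length-binary zero    zero    _  = z≤n
length-binary zero    (suc n) (s≤s ())
length-binary (suc b) n lt with halves n
... | even zero    = z≤n
... | even (suc m) rewrite binary-even m | +-identityʳ (2 ^ b) =
  s≤s (length-binary b (suc m) (double-<⁻¹ lt))
... | odd  m rewrite binary-odd m | +-identityʳ (2 ^ b) =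
  s≤s (length-binary b m (double-<⁻¹ (<-trans (n<1+n (m + m)) lt)))

-- Finiteness of sums, products and options

module _ {A B : Set} where

  finite-⊎ : Finite A → Finite B → Finite (A ⊎ B)
  finite-⊎ (m , f) (n , g) = m + n , ↔-trans (f ⊎-↔ g) (↔-sym +↔⊎)

  finite-× : Finite A → Finite B → Finite (A × B)
  finite-× (m , f) (n , g) = m * n , ↔-trans (f ×-↔ g) (↔-sym *↔×)

finite-Fin : ∀ n → Finite (Fin n)
finite-Fin n = n , mk↔ₛ′ id id (λ _ → refl) (λ _ → refl)

finite-Bool : Finite Bool
finite-Bool = 2 , ↔-sym 2↔Bool

finite-Maybe : ∀ {A : Set} → Finite A → Finite (Maybe A)
finite-Maybe (n , f) = suc n , ↔-trans Maybe↔ (↔-trans (↔-sym 1↔⊤ ⊎-↔ f) (↔-sym +↔⊎))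
  where
  Maybe↔ : ∀ {A : Set} → Maybe A ↔ (⊤ ⊎ A)
  Maybe↔ = mk↔ₛ′ (Maybe.maybe′ inj₂ (inj₁ tt)) (λ { (inj₁ _) → nothing ; (inj₂ x) → just x })
    (λ { (inj₁ _) → refl ; (inj₂ _) → refl }) (λ { nothing → refl ; (just _) → refl })

-- Tapes up to trailing blanks

module _ {Aux : Set} where

  nth : List (Symbol Aux) → ℕ → Symbol Aux
  nth []       _       = blank
  nth (x ∷ xs) zero    = x
  nth (x ∷ xs) (suc i) = nth xs i

  nth-blanks : ∀ n i → nth (replicate n blank) i ≡ blank
  nth-blanks zero    _       = refl
  nth-blanks (suc n) zero    = refl
  nth-blanks (suc n) (suc i) = nth-blanks n i

  nth-++-blank : ∀ xs i → nth (xs ++ [ blank ]) i ≡ nth xs i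
  nth-++-blank []       i       = nth-blanks 1 i
  nth-++-blank (x ∷ xs) zero    = refl
  nth-++-blank (x ∷ xs) (suc i) = nth-++-blank xs i

  -- Equality up to trailing blanks on either side.  Machines cannot tell such
  -- tapes apart, so a run may start from tapes padded with those blanks that
  -- make all later configurations come out exactly.
  infix 4 _≈_

  record _≈_ (τ τ′ : Tape Aux) : Set where
    constructor same
    field
      left  : ∀ i → nth (Tape.left τ) i ≡ nth (Tape.left τ′) i
      head  : Tape.head τ ≡ Tape.head τ′
      right : ∀ i → nth (Tape.right τ) i ≡ nth (Tape.right τ′) i

  ≈-refl : ∀ {τ} → τ ≈ τ
  ≈-refl = same (λ _ → refl) refl (λ _ → refl)

  nth-∷ : ∀ {x y xs ys} → x ≡ y → (∀ i → nth xs i ≡ nth ys i) →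
    ∀ i → nth (x ∷ xs) i ≡ nth (y ∷ ys) i
  nth-∷ x≡y eq zero    = x≡y
  nth-∷ x≡y eq (suc i) = eq i

  shift-≈ : ∀ d {τ τ′} → τ ≈ τ′ → shift d τ ≈ shift d τ′
  shift-≈ ◁ {tape [] _ _}      {tape [] _ _}      (same l h r) = same l refl (nth-∷ h r)
  shift-≈ ◁ {tape [] _ _}      {tape (_ ∷ _) _ _} (same l h r) = same (l ∘ suc) (l 0) (nth-∷ h r)
  shift-≈ ◁ {tape (_ ∷ _) _ _} {tape [] _ _}      (same l h r) = same (l ∘ suc) (l 0) (nth-∷ h r)
  shift-≈ ◁ {tape (_ ∷ _) _ _} {tape (_ ∷ _) _ _} (same l h r) = same (l ∘ suc) (l 0) (nth-∷ h r)
  shift-≈ ∙ eq = eq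
  shift-≈ ▷ {tape _ _ []}      {tape _ _ []}      (same l h r) = same (nth-∷ h l) refl r
  shift-≈ ▷ {tape _ _ []}      {tape _ _ (_ ∷ _)} (same l h r) = same (nth-∷ h l) (r 0) (r ∘ suc)
  shift-≈ ▷ {tape _ _ (_ ∷ _)} {tape _ _ []}      (same l h r) = same (nth-∷ h l) (r 0) (r ∘ suc)
  shift-≈ ▷ {tape _ _ (_ ∷ _)} {tape _ _ (_ ∷ _)} (same l h r) = same (nth-∷ h l) (r 0) (r ∘ suc)

  leadingBits-nth : ∀ xs ys → (∀ i → nth xs i ≡ nth ys i) → leadingBits xs ≡ leadingBits ys
  leadingBits-nth []       []       eq = refl
  leadingBits-nth []       (y ∷ ys) eq rewrite sym (eq 0) = refl
  leadingBits-nth (x ∷ xs) []       eq rewrite eq 0 = refl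
  leadingBits-nth (x ∷ xs) (y ∷ ys) eq with x | eq 0
  ... | blank | refl = refl
  ... | bit b | refl = cong (b ∷_) (leadingBits-nth xs ys (eq ∘ suc))
  ... | aux a | refl = refl

  contents-≈ : ∀ {τ τ′ : Tape Aux} → τ ≈ τ′ → contents τ ≡ contents τ′
  contents-≈ (same l h r) = leadingBits-nth _ _ (nth-∷ h r)

-- Bounded runs and their invariance under padding

module Reachability (𝓜 : OracleMachine) (oracle : Word → Word) where
  open OracleMachine 𝓜
  open Run 𝓜 oracle

  data _≋_ : Config → Config → Set where
    config : ∀ q {τ τ′} → Pointwise _≈_ τ τ′ → config q τ ≋ config q τ′

  heads-≈ : ∀ {n} {τ τ′ : Vec (Tape Aux) n} → Pointwise _≈_ τ τ′ →
    Vec.map Tape.head τ ≡ Vec.map Tape.head τ′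
  heads-≈ []       = refl
  heads-≈ (t ∷ ts) = cong₂ _∷_ (_≈_.head t) (heads-≈ ts)

  moves-≈ : ∀ {n} (acts : Vec _ n) {τ τ′ : Vec (Tape Aux) n} → Pointwise _≈_ τ τ′ →
    Pointwise _≈_ (Vec.zipWith writeAndShift acts τ) (Vec.zipWith writeAndShift acts τ′)
  moves-≈ []               []       = []
  moves-≈ ((x , d) ∷ acts) (t ∷ ts) =
    shift-≈ d (same (_≈_.left t) refl (_≈_.right t)) ∷ moves-≈ acts ts

  perform-≈ : ∀ act {τ τ′} → Pointwise _≈_ τ τ′ →
    MaybePointwise.Pointwise _≋_ (perform act τ) (perform act τ′)
  perform-≈ halt          ts = MaybePointwise.nothing
  perform-≈ (move q acts) ts = MaybePointwise.just (config q (moves-≈ acts ts))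
  perform-≈ (ask q) {_ ∷ τ ∷ _} (t ∷ u ∷ ts) = MaybePointwise.just (config q
    (t ∷ subst (λ w → load (oracle (contents τ)) ≈ load (oracle w)) (contents-≈ u) ≈-refl ∷ ts))

  step-≈ : ∀ {c d} → c ≋ d → MaybePointwise.Pointwise _≋_ (step c) (step d)
  step-≈ (config q {τ′ = τ′} ts) rewrite heads-≈ ts =
    perform-≈ (δ q (Vec.map Tape.head τ′)) ts

  output-≈ : ∀ {c d} → c ≋ d → output c ≡ output d
  output-≈ (config q (_ ∷ _ ∷ t ∷ _)) = contents-≈ t

  -- A step depends on the tapes only through the symbols under the heads and, for a query, the
  -- contents of the oracle tape. Equivalent tapes agree in both, so the run is replayed step by
  -- step.
  ⇓-≈ : ∀ {c d t w} → c ≋ d → d ⇓⟨ t ⟩ w → c ⇓⟨ t ⟩ w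
  ⇓-≈ {c} c≋d (stop eq) with step c in eq′ | step-≈ c≋d
  ... | _ | p rewrite eq with MaybePointwise.nothing ← p =
    subst (c ⇓⟨ 0 ⟩_) (output-≈ c≋d) (stop eq′)
  ⇓-≈ {c} c≋d (next eq d⇓) with step c in eq′ | step-≈ c≋d
  ... | _ | p rewrite eq with MaybePointwise.just c≋d′ ← p = next eq′ (⇓-≈ c≋d′ d⇓)

  infix 4 _⟶⟨_⟩_
  infixr 5 _◅_ _◅◅_

  -- The index is only an upper bound on the number of steps, since `ε` takes any index; estimates
  -- can thus be relaxed phase by phase, and `halts` recovers an exact count at the end.
  data _⟶⟨_⟩_ (c : Config) : ℕ → Config → Set where
    ε   : ∀ {t} → c ⟶⟨ t ⟩ c
    _◅_ : ∀ {t d e} → step c ≡ just d → d ⟶⟨ t ⟩ e → c ⟶⟨ suc t ⟩ e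

  weaken : ∀ {s t c d} → s ≤ t → c ⟶⟨ s ⟩ d → c ⟶⟨ t ⟩ d
  weaken s≤t       ε        = ε
  weaken (s≤s s≤t) (eq ◅ r) = eq ◅ weaken s≤t r

  _◅◅_ : ∀ {s t c d e} → c ⟶⟨ s ⟩ d → d ⟶⟨ t ⟩ e → c ⟶⟨ s + t ⟩ e
  _◅◅_ {s} {t} ε r = weaken (m≤n+m t s) r
  (eq ◅ r) ◅◅ r′   = eq ◅ (r ◅◅ r′)

  end : ∀ {t c d e} → d ≡ e → c ⟶⟨ t ⟩ d → c ⟶⟨ t ⟩ e
  end refl r = r

  halts : ∀ {t c d} → c ⟶⟨ t ⟩ d → step d ≡ nothing →
    ∃[ s ] s ≤ t × c ⇓⟨ s ⟩ output d
  halts ε eq = 0 , z≤n , stop eq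
  halts (eq′ ◅ r) eq with s , s≤t , r⇓ ← halts r eq = suc s , s≤s s≤t , next eq′ r⇓

-- Enumeration of a list by a successor function

-- Links two views of the children of a node: the machine passes from one child to the next with
-- bounded memory, while the counts are sums over a list.
data Chain {A : Set} (next : A → Maybe A) : Maybe A → List A → Set where
  []  : Chain next nothing []
  _∷_ : ∀ x {xs} → Chain next (next x) xs → Chain next (just x) (x ∷ xs)

firstFin : ∀ n → Maybe (Fin n)
firstFin zero    = nothing
firstFin (suc n) = just zero

nextFin : ∀ {n} → Fin n → Maybe (Fin n)
nextFin {suc n} zero    = Maybe.map suc (firstFin n)
nextFin {suc n} (suc i) = Maybe.map suc (nextFin i)

chain-map : ∀ {A B : Set} {nextᴬ : A → Maybe A} {nextᴮ : B → Maybe B} (f : A → B) →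
  (∀ x → nextᴮ (f x) ≡ Maybe.map f (nextᴬ x)) → ∀ {x xs} →
  Chain nextᴬ x xs → Chain nextᴮ (Maybe.map f x) (map f xs)
chain-map f eq []       = []
chain-map f eq (x ∷ ch) = f x ∷ subst (λ y → Chain _ y _) (sym (eq x)) (chain-map f eq ch)

chain-allFin : ∀ n → Chain nextFin (firstFin n) (List.allFin n)
chain-allFin zero    = []
chain-allFin (suc n) = zero ∷ subst (Chain nextFin _) (List.map-tabulate id suc)
  (chain-map suc (λ _ → refl) (chain-allFin n))

map-lookup-allFin : ∀ {A : Set} {n} (xs : Vec A n) → map (lookup xs) (List.allFin n) ≡ toList xs
map-lookup-allFin xs = trans (List.map-tabulate id (lookup xs)) (tabulate-lookup xs)
  where
  tabulate-lookup : ∀ {A : Set} {n} (xs : Vec A n) → List.tabulate (lookup xs) ≡ toList xs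
  tabulate-lookup []       = refl
  tabulate-lookup (x ∷ xs) = cong (x ∷_) (tabulate-lookup xs)

replicate-ʳ++ : ∀ {A : Set} n (x : A) xs → replicate n x ʳ++ xs ≡ replicate n x ++ xs
replicate-ʳ++ zero    x xs = refl
replicate-ʳ++ (suc n) x xs = trans (replicate-ʳ++ n x (x ∷ xs)) (shuffle n)
  where
  shuffle : ∀ n → replicate n x ++ x ∷ xs ≡ x ∷ replicate n x ++ xs
  shuffle zero    = refl
  shuffle (suc n) = cong (x ∷_) (shuffle n)

-- The backtracking oracle machine

-- Backtracking over the sequences of n edges that lead from root to an
-- accepting node, where n is the length of the block of ones at the start of
-- the input.  The stack grows to the left, and the input head moves left over
-- the ones in step with it, so a blank under the input head marks a leaf.
module Search
  {k : ℕ} {Node Edge : Set}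
  (node-finite : Finite Node) (edge-finite : Finite Edge)
  (root : Node) (accepting : Node → Bool)
  (first : Node → Maybe Edge) (sibling : Edge → Maybe Edge)
  (target : Edge → Node) (label : Edge → Subset k)
  (edges : Node → List Edge) (chain : ∀ r → Chain sibling (first r) (edges r))
  where

  State : Set
  State = Fin 8 ⊎ Bool ⊎ Node ⊎ Maybe (Fin k)

  pattern seek         = inj₁ 0F
  pattern pop          = inj₁ 1F
  pattern copy         = inj₁ 2F
  pattern rewindInput  = inj₁ 3F
  pattern rewindStack  = inj₁ 4F
  pattern rewindOracle = inj₁ 5F
  pattern query        = inj₁ 6F
  pattern rewindOutput = inj₁ 7F
  pattern adding c     = inj₂ (inj₁ c)
  pattern visit r      = inj₂ (inj₂ (inj₁ r))
  pattern emit j       = inj₂ (inj₂ (inj₂ j))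

  Sym : Set
  Sym = Symbol Edge

  digit : Sym → Bool
  digit (bit b) = b
  digit _       = false

  Act : Set
  Act = Action State Edge 4

  moves : State → (i o a s : Sym × Direction) → Act
  moves q i o a s = move q (i ∷ o ∷ a ∷ s ∷ [])

  -- The four tapes are input (i), oracle (o), output (a) and stack (s).
  descend : Maybe Edge → (i o a s : Sym) → Act
  -- The stack head then stands on the edge that led to this node, whose sibling `pop` tries next;
  -- at the root it finds a blank and the machine halts.
  descend nothing  i o a s = moves pop (i , ▷) (o , ∙) (a , ∙) (blank , ▷)
  descend (just e) i o a s = moves (visit (target e)) (i , ◁) (o , ∙) (a , ∙) (aux e , ◁)

  emission : Maybe (Fin k) → Edge → (i o a : Sym) → Act
  emission nothing  e i o a = moves (emit (firstFin k)) (i , ∙) (o , ∙) (a , ∙) (aux e , ▷)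
  emission (just j) e i o a =
    moves (emit (nextFin j)) (i , ∙) (bit (lookup (label e) j) , ▷) (a , ∙) (aux e , ∙)

  act : State → (i o a s : Sym) → Act
  act seek (bit true) o a s = moves seek (bit true , ▷) (o , ∙) (a , ∙) (s , ∙)
  act seek i          o a s = moves (visit root) (i , ◁) (o , ∙) (a , ∙) (s , ∙)
  act pop i o a (aux e) = descend (sibling e) i o a (aux e)
  act pop i o a _       = halt
  -- On acceptance each of the three moving heads leaves a blank cell to its left, where the later
  -- rewinding stops.
  act (visit r) blank o a s = if accepting r
    then moves copy (blank , ▷) (o , ▷) (a , ∙) (s , ▷)
    else descend nothing blank o a s
  act (visit r) i     o a s = descend (first r) i o a s
  act copy (bit b) o a s = moves copy (bit b , ▷) (bit b , ▷) (a , ∙) (s , ∙)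
  act copy i       o a s = moves rewindInput (i , ◁) (o , ∙) (a , ∙) (s , ∙)
  act rewindInput blank o a s = moves (emit (firstFin k)) (blank , ∙) (o , ∙) (a , ∙) (s , ∙)
  act rewindInput i     o a s = moves rewindInput (i , ◁) (o , ∙) (a , ∙) (s , ∙)
  act (emit j) i o a (aux e) = emission j e i o a
  act (emit j) i o a s       = moves rewindStack (i , ∙) (o , ◁) (a , ∙) (s , ◁)
  act rewindStack i o a blank = moves rewindOracle (i , ∙) (o , ∙) (a , ∙) (blank , ∙)
  act rewindStack i o a s     = moves rewindStack (i , ∙) (o , ∙) (a , ∙) (s , ◁)
  act rewindOracle i blank a s = moves query (i , ∙) (blank , ▷) (a , ∙) (s , ∙)
  act rewindOracle i o     a s = moves rewindOracle (i , ∙) (o , ◁) (a , ∙) (s , ∙)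
  act query _ _ _ _ = ask (adding false)
  act (adding false) i blank blank s = moves rewindOutput (i , ∙) (blank , ∙) (blank , ◁) (s , ∙)
  act (adding c)     i o     a     s = moves (adding (carryBit c (digit a) (digit o)))
    (i , ∙) (o , ▷) (bit (sumBit c (digit a) (digit o)) , ▷) (s , ∙)
  act rewindOutput i o blank s = moves pop (i , ▷) (o , ∙) (blank , ▷) (blank , ▷)
  act rewindOutput i o a     s = moves rewindOutput (i , ∙) (o , ∙) (a , ◁) (s , ∙)

  machine : OracleMachine
  machine = record
    { State        = State
    ; Aux          = Edge
    ; state-finite = finite-⊎ (finite-Fin 8)
        (finite-⊎ finite-Bool (finite-⊎ node-finite (finite-Maybe (finite-Fin k))))
    ; aux-finite   = edge-finite
    ; workTapes    = 1
    ; start        = seek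
    ; δ            = λ { q (i ∷ o ∷ a ∷ s ∷ []) → act q i o a s }
    }

  bits : Word → List Sym
  bits = map bit

  word : List Edge → Word
  word = concatMap (toList ∘ label)

  total : (List Edge → ℕ) → ℕ → Node → List Edge → ℕ
  total f zero    r es = if accepting r then f es else 0
  total f (suc m) r es = sum (map (λ e → total f m (target e) (e ∷ es)) (edges r))

  -- One summand for each phase of `write-query`, in order: copying the input, rewinding it,
  -- emitting the lists, rewinding the stack, rewinding the query. The ones are the transitions
  -- between phases.
  queryTime : (ℓ n : ℕ) → ℕ
  queryTime ℓ n = 1 + (ℓ + (1 + (ℓ + (1 + (n * (k + 1) + (1 + (n + (1 + ((ℓ + n * k) + 1)))))))))

  answerTime : ℕ → ℕ
  answerTime B = 1 + (B + (1 + (B + 1)))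

  leafTime : (ℓ n B : ℕ) → ℕ
  leafTime ℓ n B = queryTime ℓ n + answerTime B

  -- The outer step leaves the node for good, the inner ones enter its children. The cost `T` is
  -- charged to every leaf, accepting or not.
  time : ℕ → ℕ → Node → ℕ
  time T zero    r = T
  time T (suc m) r = suc (sum (map (λ e → suc (time T m (target e))) (edges r)))

  -- Correctness of the machine

  module Correctness (oracle : Word → Word) where
    open Run machine oracle public
    open Reachability machine oracle public

    four : State → (i o a s : Tape Edge) → Config
    four q i o a s = config q (i ∷ o ∷ a ∷ s ∷ [])

    -- f places a tape among three fixed ones.
    rewind : ∀ q (f : Tape Edge → Vec (Tape Edge) 4) →
      (∀ l x r → x ≢ blank →
        step (config q (f (tape l x r))) ≡ just (config q (f (shift ◁ (tape l x r))))) →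
      ∀ {xs} → All (_≢ blank) xs → ∀ {l t h r} →
      config q (f (shift ◁ (tape (xs ʳ++ (t ∷ l)) h r)))
        ⟶⟨ length xs ⟩ config q (f (tape l t (xs ++ h ∷ r)))
    rewind q f eq []       = ε
    -- The symbol next to `t` is crossed last, so its step follows the recursive run.
    rewind q f eq {x ∷ xs} (x≢ ∷ xs≢) {l} {t} =
      weaken (≤-reflexive (+-comm (length xs) 1))
        (rewind q f eq xs≢ ◅◅ eq (t ∷ l) x _ x≢ ◅ ε)

    bits≢blank : ∀ w → All (_≢ blank) (bits w)
    bits≢blank w = All.map⁺ (All.universal (λ _ ()) w)

    aux≢blank : ∀ (es : List Edge) → All (_≢ blank) (map aux es)
    aux≢blank es = All.map⁺ (All.universal (λ _ ()) es)

    rewind-input : ∀ w {l h r o a s} →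
      four rewindInput (shift ◁ (tape (bits w ʳ++ blank ∷ l) h r)) o a s
        ⟶⟨ length w ⟩
      four rewindInput (tape l blank (bits w ++ h ∷ r)) o a s
    rewind-input w {o = o} {a = a} {s = s} =
      weaken (≤-reflexive (List.length-map bit w)) (rewind rewindInput (λ i → i ∷ o ∷ a ∷ s ∷ [])
        (λ { _ blank _ x≢ → ⊥-elim (x≢ refl) ; _ (bit _) _ _ → refl ; _ (aux _) _ _ → refl })
        (bits≢blank w))

    rewind-oracle : ∀ w {l h r i a s} →
      four rewindOracle i (shift ◁ (tape (bits w ʳ++ blank ∷ l) h r)) a s
        ⟶⟨ length w ⟩
      four rewindOracle i (tape l blank (bits w ++ h ∷ r)) a s
    rewind-oracle w {i = i} {a = a} {s = s} =
      weaken (≤-reflexive (List.length-map bit w)) (rewind rewindOracle (λ o → i ∷ o ∷ a ∷ s ∷ [])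
        (λ { _ blank _ x≢ → ⊥-elim (x≢ refl) ; _ (bit _) _ _ → refl ; _ (aux _) _ _ → refl })
        (bits≢blank w))

    rewind-output : ∀ w {l h r i o s} →
      four rewindOutput i o (shift ◁ (tape (bits w ʳ++ blank ∷ l) h r)) s
        ⟶⟨ length w ⟩
      four rewindOutput i o (tape l blank (bits w ++ h ∷ r)) s
    rewind-output w {i = i} {o = o} {s = s} =
      weaken (≤-reflexive (List.length-map bit w)) (rewind rewindOutput (λ a → i ∷ o ∷ a ∷ s ∷ [])
        (λ { _ blank _ x≢ → ⊥-elim (x≢ refl) ; _ (bit _) _ _ → refl ; _ (aux _) _ _ → refl })
        (bits≢blank w))

    rewind-stack : ∀ es {l h r i o a} →
      four rewindStack i o a (shift ◁ (tape (map aux es ʳ++ blank ∷ l) h r))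
        ⟶⟨ length es ⟩
      four rewindStack i o a (tape l blank (map aux es ++ h ∷ r))
    rewind-stack es {i = i} {o = o} {a = a} =
      weaken (≤-reflexive (List.length-map aux es)) (rewind rewindStack (λ s → i ∷ o ∷ a ∷ s ∷ [])
        (λ { _ blank _ x≢ → ⊥-elim (x≢ refl) ; _ (bit _) _ _ → refl ; _ (aux _) _ _ → refl })
        (aux≢blank es))

    copying : ∀ w {l h p a s} →
      four copy (shift ▷ (tape l h (bits w ++ [ blank ]))) (tape p blank []) a s
        ⟶⟨ length w ⟩
      four copy (tape (bits w ʳ++ h ∷ l) blank []) (tape (bits w ʳ++ p) blank []) a s
    copying []      = ε
    copying (b ∷ w) = refl ◅ copying w

    emit-label : ∀ {e j js} → Chain nextFin j js → ∀ {i p a l r} →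
      four (emit j) i (tape p blank []) a (tape l (aux e) r)
        ⟶⟨ length js ⟩
      four (emit nothing) i (tape (bits (map (lookup (label e)) js) ʳ++ p) blank []) a
        (tape l (aux e) r)
    emit-label []       = ε
    emit-label (j ∷ ch) = refl ◅ emit-label ch

    emit-edge : ∀ e {i p a l r} →
      four (emit (firstFin k)) i (tape p blank []) a (tape l (aux e) r)
        ⟶⟨ k + 1 ⟩
      four (emit (firstFin k)) i (tape (bits (toList (label e)) ʳ++ p) blank []) a
        (shift ▷ (tape l (aux e) r))
    emit-edge e {p = p} =
      weaken (≤-reflexive (cong (_+ 1) (List.length-tabulate {n = k} id)))
        (end (cong (λ w → four _ _ (tape (bits w ʳ++ p) blank []) _ _) (map-lookup-allFin (label e)))
          (emit-label (chain-allFin k) ◅◅ refl ◅ ε))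

    bits-ʳ++ : ∀ v w {xs} → bits w ʳ++ (bits v ʳ++ xs) ≡ bits (v ++ w) ʳ++ xs
    bits-ʳ++ v w {xs} =
      trans (sym (List.++-ʳ++ (bits v))) (cong (_ʳ++ xs) (sym (List.map-++ bit v w)))

    emit-edges : ∀ es {i p a l h} →
      four (emit (firstFin k)) i (tape p blank []) a (shift ▷ (tape l h (map aux es ++ [ blank ])))
        ⟶⟨ length es * (k + 1) ⟩
      four (emit (firstFin k)) i (tape (bits (word es) ʳ++ p) blank []) a
        (tape (map aux es ʳ++ h ∷ l) blank [])
    emit-edges []       = ε
    emit-edges (e ∷ es) =
      emit-edge e ◅◅
      end (cong (λ p → four _ _ (tape p blank []) _ _) (bits-ʳ++ (toList (label e)) (word es)))
        (emit-edges es)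

    atRight : List Sym → List Sym → Tape Edge
    atRight l []      = tape l blank []
    atRight l (x ∷ r) = tape l x r

    shift▷ : ∀ l h r → shift ▷ (tape l h r) ≡ atRight (h ∷ l) r
    shift▷ l h []      = refl
    shift▷ l h (_ ∷ _) = refl

    load-atRight : ∀ w → load w ≡ atRight [] (bits w)
    load-atRight []      = refl
    load-atRight (_ ∷ _) = refl

    add-step : ∀ r r′ {t q i x p y p′ s j a z c} →
      step c ≡ just (four q i (shift ▷ (tape p x r)) (shift ▷ (tape p′ y r′)) s) →
      ∃[ p″ ] four q i (atRight (x ∷ p) r) (atRight (y ∷ p′) r′) s
        ⟶⟨ t ⟩ four (adding false) j (tape p″ blank []) a z →
      ∃[ p″ ] c ⟶⟨ suc t ⟩ four (adding false) j (tape p″ blank []) a z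
    add-step r r′ {x = x} {p} {y} {p′} eq (p″ , run)
      rewrite shift▷ p x r | shift▷ p′ y r′ = p″ , eq ◅ run

    -- The digits of the answer stay behind on the left of the oracle tape as the debris `p″`. It is
    -- harmless: the next query is written to the right of a blank, and its answer replaces the
    -- whole tape.
    addition : ∀ c u v {i p p′ s} → ∃[ p″ ]
      four (adding c) i (atRight p (bits v)) (atRight p′ (bits u ++ [ blank ])) s
        ⟶⟨ length (add c u v) ⟩
      four (adding false) i (tape p″ blank []) (tape (bits (add c u v) ʳ++ p′) blank []) s
    addition false []      []      = _ , ε
    addition true  []      []      = _ , refl ◅ ε
    addition false []      (b ∷ v) = add-step (bits v) [] refl (addition _ [] v)
    addition true  []      (b ∷ v) = add-step (bits v) [] refl (addition _ [] v)
    addition false (a ∷ u) []      = add-step [] (bits u ++ [ blank ]) refl (addition _ u [])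
    addition true  (a ∷ u) []      = add-step [] (bits u ++ [ blank ]) refl (addition _ u [])
    addition false (a ∷ u) (b ∷ v) = add-step (bits v) (bits u ++ [ blank ]) refl (addition _ u v)
    addition true  (a ∷ u) (b ∷ v) = add-step (bits v) (bits u ++ [ blank ]) refl (addition _ u v)

    contents-bits : ∀ w {l h} → contents (shift ▷ (tape l h (bits w ++ [ blank ]))) ≡ w
    contents-bits []      = refl
    contents-bits (b ∷ w) = cong (b ∷_) (leadingBits-bits w)
      where
      leadingBits-bits : ∀ w → leadingBits (bits w ++ [ blank ]) ≡ w
      leadingBits-bits []      = refl
      leadingBits-bits (b ∷ w) = cong (b ∷_) (leadingBits-bits w)

    -- The left blank stops the rewinding; the right one is the cell on which the adding head
    -- recognises the end. With both listed from the start, the tape has the same form before and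
    -- after every leaf.
    counter : ℕ → Tape Edge
    counter n = shift ▷ (tape [] blank (bits (binary n) ++ [ blank ]))

    length-word : ∀ es → length (word es) ≡ length es * k
    length-word []       = refl
    length-word (e ∷ es) = trans (List.length-++ (toList (label e)))
      (cong₂ _+_ (Vec.length-toList (label e)) (length-word es))

    inputTape : Word → Tape Edge
    inputTape w = tape [] blank (bits w ++ [ blank ])

    -- The `m` blanks on the left are the cells that the remaining `m` decisions may use. Listing
    -- them in advance makes a descent followed by a return restore the tape exactly.
    stackTape : ℕ → List Edge → Tape Edge
    stackTape m es = tape (replicate m blank) blank (map aux es ++ [ blank ])

    queryTape : List Sym → Word → Tape Edge
    queryTape p w = shift ▷ (tape p blank (bits w ++ [ blank ]))

    write-query : ∀ w es {r p a} → accepting r ≡ true →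
      four (visit r) (inputTape w) (tape p blank []) a (stackTape 0 es)
        ⟶⟨ queryTime (length w) (length es) ⟩
      four query (inputTape w) (queryTape p (w ++ word es)) a (stackTape 0 es)
    write-query w es {r} {p} {a} accept =
      accepted ◅ copying w ◅◅ refl ◅ rewind-input w ◅◅ refl ◅
      emit-edges es ◅◅ refl ◅ rewind-stack es ◅◅ refl ◅ rewind-query ◅◅ refl ◅ ε
      where
      accepted : step (four (visit r) (inputTape w) (tape p blank []) a (stackTape 0 es)) ≡
        just (four copy (shift ▷ (inputTape w)) (tape (blank ∷ p) blank []) a
          (shift ▷ (stackTape 0 es)))
      accepted rewrite accept = refl

      rewind-query : four rewindOracle (inputTape w)
          (shift ◁ (tape (bits (word es) ʳ++ (bits w ʳ++ blank ∷ p)) blank [])) a (stackTape 0 es)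
        ⟶⟨ length w + length es * k ⟩
        four rewindOracle (inputTape w) (tape p blank (bits (w ++ word es) ++ [ blank ])) a
          (stackTape 0 es)
      rewind-query rewrite bits-ʳ++ w (word es) {blank ∷ p} =
        weaken (≤-reflexive (trans (List.length-++ w) (cong (length w +_) (length-word es))))
          (rewind-oracle (w ++ word es))

    add-answer : ∀ {w p a b B i l r} → oracle w ≡ binary b → length (binary (a + b)) ≤ B →
      ∃[ p′ ]
      four query i (queryTape p w) (counter a) (tape l blank r)
        ⟶⟨ answerTime B ⟩
      four pop (shift ▷ i) (tape p′ blank []) (counter (a + b)) (shift ▷ (tape l blank r))
    add-answer {w} {p} {a} {b} answer short
      with p′ , adds ← addition false (binary a) (binary b) {p = []} {p′ = [ blank ]}
      rewrite add-binary a b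
        | shift▷ [] blank (bits (binary a) ++ [ blank ])
      = p′ , asked ◅ weaken short adds ◅◅ refl ◅
        weaken short (rewind-output (binary (a + b))) ◅◅ refl ◅ ε
      where
      asked : ∀ {i a s} → step (four query i (queryTape p w) a s) ≡
        just (four (adding false) i (atRight [] (bits (binary b))) a s)
      asked {i} {a} {s} = cong (λ τ → just (four (adding false) i τ a s))
        (trans (cong (load ∘ oracle) (contents-bits w))
          (trans (cong load answer) (load-atRight (binary b))))

    inputAt : ℕ → List Sym → Tape Edge
    inputAt zero    r = tape [] blank r
    inputAt (suc m) r = tape (replicate m (bit true) ++ [ blank ]) (bit true) r

    shift◁-inputAt : ∀ m r → shift ◁ (inputAt (suc m) r) ≡ inputAt m (bit true ∷ r)
    shift◁-inputAt zero    r = refl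
    shift◁-inputAt (suc m) r = refl

    shift▷-inputAt : ∀ m r → shift ▷ (inputAt m (bit true ∷ r)) ≡ inputAt (suc m) r
    shift▷-inputAt zero    r = refl
    shift▷-inputAt (suc m) r = refl

    seeking : ∀ m j r {o a s} →
      four seek (shift ▷ (inputAt j (replicate m (bit true) ++ bit false ∷ r))) o a s
        ⟶⟨ suc m ⟩
      four (visit root) (inputAt (m + j) (bit false ∷ r)) o a s
    seeking zero zero    r = refl ◅ ε
    seeking zero (suc j) r = refl ◅ ε
    seeking (suc m) j    r {o} {a} {s}
      rewrite shift▷-inputAt j (replicate m (bit true) ++ bit false ∷ r) = refl ◅
        end (cong (λ i → four (visit root) (inputAt i (bit false ∷ r)) o a s) (+-suc m j))
          (seeking m (suc j) r)

    module _ (n : ℕ) (v : Word) (B X : ℕ) (f : List Edge → ℕ)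
      (answers : ∀ es → length es ≡ n →
        oracle ((replicate n true ++ false ∷ v) ++ word es) ≡ binary (f es))
      (short : ∀ x → x ≤ X → length (binary x) ≤ B)
      where

      w : Word
      w = replicate n true ++ false ∷ v

      T : ℕ
      T = leafTime (length w) n B

      -- The invariant of the search: each undecided vertex corresponds to a 1 of the unary block at
      -- or to the left of the input head, and the input itself is intact.
      Position : ℕ → List Edge → List Sym → Set
      Position m es rest = m + length es ≡ n × replicate m (bit true) ʳ++ rest ≡ bits w ++ [ blank ]

      -- Mutual induction with `descending`, over the height `m` and the list of children. The
      -- hypothesis on `X` bounds the accumulator after the whole subtree, hence also at every
      -- moment before.
      visiting : ∀ m r {es rest p a} → Position m es rest → a + total f m r es ≤ X → ∃[ p′ ]
        four (visit r) (inputAt m rest) (tape p blank []) (counter a) (stackTape m es)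
          ⟶⟨ time T m r ⟩
        four pop (shift ▷ (inputAt m rest)) (tape p′ blank []) (counter (a + total f m r es))
          (shift ▷ (stackTape m es))

      -- Covers both ways of reaching a child: entering the node for the first time (`q` is
      -- `visit r`, blank `h`) and moving on to a sibling (`q` is `pop`, `h` the previous edge). All
      -- that matters is that `q` acts like `descend x`.
      descending : ∀ m q {x fs es rest p a h} → Chain sibling x fs → Position (suc m) es rest →
        a + sum (map (λ e → total f m (target e) (e ∷ es)) fs) ≤ X →
        (∀ y → act q (bit true) blank y h ≡ descend x (bit true) blank y h) → ∃[ p′ ]
        four q (inputAt (suc m) rest) (tape p blank []) (counter a)
            (tape (replicate (suc m) blank) h (map aux es ++ [ blank ]))
          ⟶⟨ suc (sum (map (λ e → suc (time T m (target e))) fs)) ⟩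
        four pop (shift ▷ (inputAt (suc m) rest)) (tape p′ blank [])
          (counter (a + sum (map (λ e → total f m (target e) (e ∷ es)) fs)))
          (shift ▷ (stackTape (suc m) es))

      visiting zero r {es} {p = p} {a} (refl , refl) bound with accepting r in accept
      ... | true with p′ , adds ← add-answer {p = p} {a} (answers es refl) (short _ bound) =
        p′ , write-query w es accept ◅◅ adds
      ... | false rewrite +-identityʳ a = -, rejected ◅ ε
        where
        rejected :
          step (four (visit r) (inputTape w) (tape p blank []) (counter a) (stackTape 0 es)) ≡
          just (four pop (shift ▷ (inputTape w)) (tape p blank []) (counter a)
            (shift ▷ (stackTape 0 es)))
        rejected rewrite accept = refl
      visiting (suc m) r position bound = descending m (visit r) (chain r) position bound (λ _ → refl)

      descending m q {a = a} [] position bound eq rewrite +-identityʳ a =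
        -, cong (λ act → perform act (_ ∷ _ ∷ counter a ∷ _ ∷ [])) (eq (Tape.head (counter a))) ◅ ε
      descending m q {es = es} {rest} {p} {a} {h} (_∷_ e {fs} ch) (len , input) bound eq
        -- The first child needs only its own share of the bound; the siblings start from the
        -- accumulator that it leaves, so their bound is the given one reassociated.
        with p₁ , run₁ ← visiting m (target e) {e ∷ es} {bit true ∷ rest} {p} {a}
          (trans (+-suc m _) len , input) (≤-trans (+-monoʳ-≤ a (m≤m+n _ _)) bound)
        with p₂ , run₂ ← descending m pop
          {es = es} {rest} {p₁} {a + total f m (target e) (e ∷ es)} {aux e} ch (len , input)
          (subst (_≤ X) (sym (+-assoc a _ _)) bound) (λ _ → refl)
        rewrite shift▷-inputAt m rest
              | +-assoc a (total f m (target e) (e ∷ es))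
                  (sum (map (λ e → total f m (target e) (e ∷ es)) fs))
        = p₂ , entered ◅ weaken (≤-reflexive (+-suc (time T m (target e)) _)) (run₁ ◅◅ run₂)
        where
        entered : step (four q (inputAt (suc m) rest) (tape p blank []) (counter a)
            (tape (replicate (suc m) blank) h (map aux es ++ [ blank ]))) ≡
          just (four (visit (target e)) (inputAt m (bit true ∷ rest)) (tape p blank [])
          (counter a) (stackTape m (e ∷ es)))
        entered = trans
          (cong (λ act → perform act (_ ∷ _ ∷ counter a ∷ _ ∷ [])) (eq (Tape.head (counter a))))
          (cong (λ i → just (four _ i _ _ _)) (shift◁-inputAt m rest))

      bits-input : bits w ++ [ blank ] ≡ replicate n (bit true) ++ bit false ∷ bits v ++ [ blank ]
      bits-input = trans (cong (_++ [ blank ]) (trans (List.map-++ bit (replicate n true) _)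
          (cong (_++ bit false ∷ bits v) (List.map-replicate bit n true))))
        (List.++-assoc (replicate n (bit true)) _ _)

      start≈ : initial w ≋
        four seek (shift ▷ (inputTape w)) (tape [] blank []) (counter 0) (stackTape n [])
      start≈ = config seek (input≈ w ∷ ≈-refl ∷ same (λ i → sym (nth-blanks 1 i)) refl (λ _ → refl) ∷
        same (λ i → sym (nth-blanks n i)) refl (λ i → sym (nth-blanks 1 i)) ∷ [])
        where
        input≈ : ∀ w → load w ≈ shift ▷ (inputTape w)
        input≈ []      = same (λ i → sym (nth-blanks 1 i)) refl (λ _ → refl)
        input≈ (b ∷ w) = same (λ i → sym (nth-blanks 1 i)) refl (λ i → sym (nth-++-blank (bits w) i))

      computes : total f n root [] ≤ X →
        ∃[ t ] t ≤ suc n + time T n root × initial w ⇓⟨ t ⟩ binary (total f n root [])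
      computes bound
        with p , run ← visiting n root {[]} {bit false ∷ bits v ++ [ blank ]} {[]} {0}
          (+-identityʳ n , trans (replicate-ʳ++ n (bit true) _) (sym bits-input)) bound
        with t , t≤ , halted ← halts
          (end (cong (λ m → four (visit root) (inputAt m (bit false ∷ bits v ++ [ blank ]))
              (tape [] blank []) (counter 0) (stackTape n [])) (+-identityʳ n))
            (seeking n 0 (bits v ++ [ blank ])) ◅◅ run) refl
        = t , t≤ , ⇓-≈
            (subst (λ i → initial w ≋ four seek (shift ▷ (tape [] blank i)) (tape [] blank []) (counter 0)
              (stackTape n [])) bits-input start≈)
            (subst (_ ⇓⟨ t ⟩_) (contents-bits (binary (total f n root [])) {[]} {blank}) halted)

-- Indicators and finite sums

𝟙 : ∀ {A : Set} → Dec A → ℕ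
𝟙 a? = if does a? then 1 else 0

𝟙-⇔ : ∀ {A B : Set} → A ⇔ B → (a? : Dec A) (b? : Dec B) → 𝟙 a? ≡ 𝟙 b?
𝟙-⇔ A⇔B a? b? = cong (if_then 1 else 0) (does-⇔ A⇔B a? b?)

𝟙-yes : ∀ {A : Set} (a? : Dec A) → A → 𝟙 a? ≡ 1
𝟙-yes a? a = cong (if_then 1 else 0) (dec-true a? a)

𝟙-no : ∀ {A : Set} (a? : Dec A) → ¬ A → 𝟙 a? ≡ 0
𝟙-no a? ¬a = cong (if_then 1 else 0) (dec-false a? ¬a)

𝟙-× : ∀ {A B : Set} (a? : Dec A) (b? : Dec B) → 𝟙 (a? ×-dec b?) ≡ 𝟙 a? * 𝟙 b?
𝟙-× (yes _) (yes _) = refl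
𝟙-× (yes _) (no _)  = refl
𝟙-× (no _)  _       = refl

sum-0 : ∀ {A : Set} (xs : List A) → sum (map (λ _ → 0) xs) ≡ 0
sum-0 []       = refl
sum-0 (_ ∷ xs) = sum-0 xs

sum-+ : ∀ {A : Set} (f g : A → ℕ) xs →
  sum (map (λ x → f x + g x) xs) ≡ sum (map f xs) + sum (map g xs)
sum-+ f g []       = refl
sum-+ f g (x ∷ xs) rewrite sum-+ f g xs = interchange (f x) (g x) _ _
  where
  interchange : ∀ a b c d → a + b + (c + d) ≡ a + c + (b + d)
  interchange = solve-∀

sum-swap : ∀ {A B : Set} (h : A → B → ℕ) xs ys →
  sum (map (λ x → sum (map (h x) ys)) xs) ≡ sum (map (λ y → sum (map (λ x → h x y) xs)) ys)
sum-swap h []       ys = sym (sum-0 ys)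
sum-swap h (x ∷ xs) ys = trans (cong (_ +_) (sum-swap h xs ys)) (sym (sum-+ (h x) _ ys))

sum-cong : ∀ {A : Set} {f g : A → ℕ} → (∀ x → f x ≡ g x) → ∀ xs →
  sum (map f xs) ≡ sum (map g xs)
sum-cong eq xs = cong sum (List.map-cong eq xs)

sum-tabulate-single : ∀ {n} (f : Fin n → ℕ) i → (∀ j → j ≢ i → f j ≡ 0) →
  sum (tabulate f) ≡ f i
sum-tabulate-single f zero others = trans
  (cong (f zero +_) (sum-tabulate-0 (f ∘ suc) (λ j → others (suc j) λ ())))
  (+-identityʳ (f zero))
  where
  sum-tabulate-0 : ∀ {n} (f : Fin n → ℕ) → (∀ j → f j ≡ 0) → sum (tabulate f) ≡ 0
  sum-tabulate-0 {zero}  f eq = refl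
  sum-tabulate-0 {suc n} f eq = cong₂ _+_ (eq zero) (sum-tabulate-0 (f ∘ suc) (eq ∘ suc))
sum-tabulate-single f (suc i) others rewrite others zero (λ ()) =
  sum-tabulate-single (f ∘ suc) i (λ j j≢i → others (suc j) (j≢i ∘ Fin.suc-injective))

sum-tabulate-suc : ∀ {n} (f g : Fin n → ℕ) i → f i ≡ suc (g i) → (∀ j → j ≢ i → f j ≡ g j) →
  sum (tabulate f) ≡ suc (sum (tabulate g))
sum-tabulate-suc f g zero    eq others = cong₂ _+_ eq
  (cong sum (List.tabulate-cong (λ j → others (suc j) λ ())))
sum-tabulate-suc f g (suc i) eq others = trans
  (cong₂ _+_ (others zero λ ()) (sum-tabulate-suc (f ∘ suc) (g ∘ suc) i eq
    (λ j j≢i → others (suc j) (j≢i ∘ Fin.suc-injective))))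
  (+-suc (g zero) _)

≤-sum-tabulate : ∀ {n} (f : Fin n → ℕ) i → f i ≤ sum (tabulate f)
≤-sum-tabulate f zero    = m≤m+n (f zero) _
≤-sum-tabulate f (suc i) = ≤-trans (≤-sum-tabulate (f ∘ suc) i) (m≤n+m _ (f zero))

sum-tabulate-≤ : ∀ {n} (f : Fin n → ℕ) b → (∀ i → f i ≤ b) → sum (tabulate f) ≤ n * b
sum-tabulate-≤ {zero}  f b f≤b = z≤n
sum-tabulate-≤ {suc n} f b f≤b = +-mono-≤ (f≤b zero) (sum-tabulate-≤ (f ∘ suc) b (f≤b ∘ suc))

length-filter-× : ∀ {A : Set} {P Q : A → Set} (P? : Decidable P) (Q? : Decidable Q) xs →
  length (filter (λ x → P? x ×-dec Q? x) xs) ≡ sum (map (λ x → 𝟙 (Q? x)) (filter P? xs))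
length-filter-× P? Q? []       = refl
length-filter-× P? Q? (x ∷ xs) with P? x
... | no _  = length-filter-× P? Q? xs
... | yes _ with Q? x
...   | yes _ = cong suc (length-filter-× P? Q? xs)
...   | no _  = length-filter-× P? Q? xs

-- Occurrences of classes in a sequence

module _ {k : ℕ} where

  occurrences : Fin k → List (Fin k) → ℕ
  occurrences d []      = 0
  occurrences d (x ∷ τ) = 𝟙 (x ≟ᶠ d) + occurrences d τ

  occurrences-ʳ++ : ∀ d τ ρ → occurrences d (τ ʳ++ ρ) ≡ occurrences d τ + occurrences d ρ
  occurrences-ʳ++ d []      ρ = refl
  occurrences-ʳ++ d (x ∷ τ) ρ rewrite occurrences-ʳ++ d τ (x ∷ ρ) =
    exchange (occurrences d τ) (𝟙 (x ≟ᶠ d)) (occurrences d ρ)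
    where
    exchange : ∀ a b c → a + (b + c) ≡ b + a + c
    exchange = solve-∀

  count-occurrences : ∀ d {n} (σ : Vec (Fin k) n) →
    Vec.count (_≟ᶠ d) σ ≡ occurrences d (toList σ)
  count-occurrences d []      = refl
  count-occurrences d (x ∷ σ) with does (x ≟ᶠ d)
  ... | true  = cong suc (count-occurrences d σ)
  ... | false = count-occurrences d σ

  Occurs : (Fin k → ℕ) → List (Fin k) → Set
  Occurs C τ = ∀ d → C d ≤ occurrences d τ

  occurs? : ∀ C → Decidable (Occurs C)
  occurs? C τ = all? λ d → C d ≤? occurrences d τ

  -- An occurrence of `x` uses up one unit of its requirement. As `pred 0` is 0, this includes
  -- `C′ = C` when `C x` is 0, so it serves free and taken vertices alike.
  Occurs-∷ : ∀ {C C′ : Fin k → ℕ} x τ → C′ x ≡ pred (C x) → (∀ d → d ≢ x → C′ d ≡ C d) →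
    Occurs C (x ∷ τ) ⇔ Occurs C′ τ
  Occurs-∷ {C} {C′} x τ C′x others = mk⇔ to from
    where
    to : Occurs C (x ∷ τ) → Occurs C′ τ
    to occ d with x ≟ᶠ d | occ d
    ... | yes refl | o rewrite C′x           = pred-mono-≤ o
    ... | no x≢d   | o rewrite others d (x≢d ∘ sym) = o

    from : Occurs C′ τ → Occurs C (x ∷ τ)
    from occ d with x ≟ᶠ d | occ d
    ... | yes refl | o rewrite C′x           = ≤-trans (≤-suc-pred (C x)) (s≤s o)
      where
      ≤-suc-pred : ∀ n → n ≤ suc (pred n)
      ≤-suc-pred zero    = z≤n
      ≤-suc-pred (suc n) = ≤-refl
    ... | no x≢d   | o rewrite others d (x≢d ∘ sym) = o

-- The search tree of unmet requirements

module Requirements {k : ℕ} (C : Fin k → ℕ) where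

  bound : ℕ
  bound = sum (tabulate C)

  -- A function from `Fin k` to `Fin (suc bound)` coded as a number, since `Finite` asks for a
  -- bijection with some `Fin n` up to propositional equality. Every requirement is at most `bound`,
  -- so one common range is enough.
  Residue : Set
  Residue = Fin (suc bound ^ k)

  residual : Residue → Fin k → ℕ
  residual r d = toℕ (finToFun {suc bound} {k} r d)

  full : Residue
  full = funToFin λ d → fromℕ< (s≤s (≤-sum-tabulate C d))

  residual-full : ∀ d → residual full d ≡ C d
  residual-full d = trans (cong toℕ (finToFun-funToFin {k} _ d)) (toℕ-fromℕ< _)

  lowerAt : Fin k → Residue → Fin k → Fin (suc bound)
  lowerAt d r i = (if does (i ≟ᶠ d) then Fin.pred else id) (finToFun {suc bound} {k} r i)

  lower : Fin k → Residue → Residue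
  lower d r = funToFin (lowerAt d r)

  residual-lower-≡ : ∀ d r → residual (lower d r) d ≡ pred (residual r d)
  residual-lower-≡ d r
    rewrite finToFun-funToFin {k} (lowerAt d r) d
      | dec-true (d ≟ᶠ d) refl = toℕ-pred (finToFun {suc bound} {k} r d)
    where
    toℕ-pred : ∀ {n} (i : Fin n) → toℕ (Fin.pred i) ≡ pred (toℕ i)
    toℕ-pred zero    = refl
    toℕ-pred (suc i) = toℕ-inject₁ i

  residual-lower-≢ : ∀ d r i → i ≢ d → residual (lower d r) i ≡ residual r i
  residual-lower-≢ d r i i≢d
    rewrite finToFun-funToFin {k} (lowerAt d r) i
      | dec-false (i ≟ᶠ d) i≢d = refl

  -- The node just r records the requirements still unmet; nothing is a dead
  -- end, reached by taking a vertex for a class without unmet requirement.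
  -- The edge (zero , r) leaves a vertex free, (suc d , r) takes it for d.
  Node Edge : Set
  Node = Maybe Residue
  Edge = Fin (suc k) × Residue

  first : Node → Maybe Edge
  first = Maybe.map (zero ,_)

  -- An edge carries the residue of its source, so the next sibling is determined by the stack
  -- symbol alone.
  sibling : Edge → Maybe Edge
  sibling (c , r) = Maybe.map (_, r) (nextFin c)

  edges : Node → List Edge
  edges nothing  = []
  edges (just r) = map (_, r) (List.allFin (suc k))

  chain : ∀ r → Chain sibling (first r) (edges r)
  chain nothing  = []
  chain (just r) = chain-map (_, r) (λ _ → refl) (chain-allFin (suc k))

  lowered : Fin k → Residue → Node
  lowered d r = if does (residual r d ≟ 0) then nothing else just (lower d r)

  target : Edge → Node
  target (zero  , r) = just r
  target (suc d , r) = lowered d r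

  label : Edge → Subset k
  label (zero  , r) = Vec.tabulate λ d → does (residual r d ≟ 0)
  label (suc d , r) = ⁅ d ⁆

  accepting : Node → Bool
  accepting nothing  = false
  accepting (just r) = does (occurs? (residual r) [])

  open Search (finite-Maybe (finite-Fin (suc bound ^ k)))
    (finite-× (finite-Fin (suc k)) (finite-Fin (suc bound ^ k)))
    (just full) accepting first sibling target label edges chain public

  sum-edges : ∀ (h : Edge → ℕ) r →
    sum (map h (edges (just r))) ≡ h (zero , r) + sum (tabulate λ d → h (suc d , r))
  sum-edges h r = cong (h (zero , r) +_) (cong sum
    (trans (cong (map h) (List.map-tabulate suc (_, r))) (List.map-tabulate (λ d → suc d , r) h)))

  fits : List (Fin k) → List Edge → ℕ
  fits []      []       = 1
  fits (x ∷ ρ) (e ∷ es) = 𝟙 (x ∈? label e) * fits ρ es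
  fits _       _        = 0

  total-nothing : ∀ f m es → total f m nothing es ≡ 0
  total-nothing f zero    es = refl
  total-nothing f (suc m) es = refl

  ∈-free : ∀ x r → residual r x ≡ 0 → x ∈ label (zero , r)
  ∈-free x r eq = lookup⇒[]= x _ (trans (lookup∘tabulate _ x) (dec-true (residual r x ≟ 0) eq))

  ∉-free : ∀ x r → residual r x ≢ 0 → x ∉ label (zero , r)
  ∉-free x r neq x∈ with () ← trans (sym (dec-false (residual r x ≟ 0) neq))
    (trans (sym (lookup∘tabulate _ x)) ([]=⇒lookup x∈))

  -- Exactly one sequence of decisions fits a given σ = τ ʳ++ ρ if σ satisfies
  -- the remaining requirements on τ, and none otherwise.
  total-fits : ∀ τ ρ r es → total (fits (τ ʳ++ ρ)) (length τ) (just r) es ≡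
    𝟙 (occurs? (residual r) τ) * fits ρ es
  total-fits [] ρ r es with does (occurs? (residual r) [])
  ... | true  = sym (+-identityʳ _)
  ... | false = refl
  -- Deciding `x` moves it from the unread to the read part, and σ is unchanged because
  -- `(x ∷ τ) ʳ++ ρ` is `τ ʳ++ (x ∷ ρ)` by definition.
  total-fits (x ∷ τ) ρ r es =
    trans (sum-edges (λ e → total f (length τ) (target e) (e ∷ es)) r)
      (trans (cong₂ _+_ (total-fits τ (x ∷ ρ) r ((zero , r) ∷ es)) (sum-tabulate-single take x take-≢))
        (by-residual (residual r x) refl))
    where
    f : List Edge → ℕ
    f = fits (τ ʳ++ (x ∷ ρ))

    take : Fin k → ℕ
    take d = total f (length τ) (lowered d r) ((suc d , r) ∷ es)

    take-0 : ∀ d → residual r d ≡ 0 → take d ≡ 0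
    take-0 d eq rewrite dec-true (residual r d ≟ 0) eq = total-nothing f (length τ) _

    take-suc : ∀ d → residual r d ≢ 0 →
      take d ≡ 𝟙 (occurs? (residual (lower d r)) τ) * (𝟙 (x ∈? ⁅ d ⁆) * fits ρ es)
    take-suc d neq rewrite dec-false (residual r d ≟ 0) neq =
      total-fits τ (x ∷ ρ) (lower d r) ((suc d , r) ∷ es)

    take-≢ : ∀ d → d ≢ x → take d ≡ 0
    take-≢ d d≢x with residual r d ≟ 0
    ... | yes eq = take-0 d eq
    ... | no neq = trans (take-suc d neq) (trans
      (cong (λ i → 𝟙 (occurs? (residual (lower d r)) τ) * (i * fits ρ es))
        (𝟙-no (x ∈? ⁅ d ⁆) (d≢x ∘ sym ∘ x∈⁅y⁆⇒x≡y d)))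
      (*-zeroʳ (𝟙 (occurs? (residual (lower d r)) τ))))

    by-residual : ∀ y → residual r x ≡ y →
      𝟙 (occurs? (residual r) τ) * (𝟙 (x ∈? label (zero , r)) * fits ρ es) + take x ≡
      𝟙 (occurs? (residual r) (x ∷ τ)) * fits ρ es
    -- The requirement of `x` is met: the free list contains `x`, and taking the vertex for `x` is a
    -- dead end.
    by-residual zero eq = begin
      𝟙 (occurs? (residual r) τ) * (𝟙 (x ∈? label (zero , r)) * fits ρ es) + take x
        ≡⟨ cong₂ (λ i j → 𝟙 (occurs? (residual r) τ) * (i * fits ρ es) + j)
             (𝟙-yes (x ∈? label (zero , r)) (∈-free x r eq)) (take-0 x eq) ⟩
      𝟙 (occurs? (residual r) τ) * (1 * fits ρ es) + 0
        ≡⟨ simplify (𝟙 (occurs? (residual r) τ)) (fits ρ es) ⟩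
      𝟙 (occurs? (residual r) τ) * fits ρ es
        ≡⟨ cong (_* fits ρ es)
             (𝟙-⇔ (Occurs-∷ {C = residual r} x τ (trans eq (sym (cong pred eq))) (λ _ _ → refl))
             (occurs? (residual r) (x ∷ τ)) (occurs? (residual r) τ)) ⟨
      𝟙 (occurs? (residual r) (x ∷ τ)) * fits ρ es ∎
      where
      open ≡-Reasoning
      simplify : ∀ a b → a * (1 * b) + 0 ≡ a * b
      simplify = solve-∀
    -- The requirement of `x` is unmet: the free list excludes `x`, so only taking the vertex for
    -- `x` contributes.
    by-residual (suc y) eq = begin
      𝟙 (occurs? (residual r) τ) * (𝟙 (x ∈? label (zero , r)) * fits ρ es) + take x
        ≡⟨ cong₂ (λ i j → 𝟙 (occurs? (residual r) τ) * (i * fits ρ es) + j)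
             (𝟙-no (x ∈? label (zero , r)) (∉-free x r ≢0)) (take-suc x ≢0) ⟩
      𝟙 (occurs? (residual r) τ) * 0 + S * (𝟙 (x ∈? ⁅ x ⁆) * fits ρ es)
        ≡⟨ cong (λ i → 𝟙 (occurs? (residual r) τ) * 0 + S * (i * fits ρ es))
             (𝟙-yes (x ∈? ⁅ x ⁆) (x∈⁅x⁆ x)) ⟩
      𝟙 (occurs? (residual r) τ) * 0 + S * (1 * fits ρ es)
        ≡⟨ simplify (𝟙 (occurs? (residual r) τ)) S (fits ρ es) ⟩
      S * fits ρ es
        ≡⟨ cong (_* fits ρ es)
             (𝟙-⇔ (Occurs-∷ x τ (residual-lower-≡ x r) (residual-lower-≢ x r))
             (occurs? (residual r) (x ∷ τ)) (occurs? (residual (lower x r)) τ)) ⟨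
      𝟙 (occurs? (residual r) (x ∷ τ)) * fits ρ es ∎
      where
      open ≡-Reasoning
      S : ℕ
      S = 𝟙 (occurs? (residual (lower x r)) τ)
      ≢0 : residual r x ≢ 0
      ≢0 eq′ with () ← trans (sym eq) eq′
      simplify : ∀ a b c → a * 0 + b * (1 * c) ≡ b * c
      simplify = solve-∀

  -- The machine adds up over leaves, the count ranges over partitions; linearity of `total` in the
  -- leaf values interchanges the two sums.
  total-sum : ∀ {A : Set} (h : A → List Edge → ℕ) xs m r es →
    total (λ es → sum (map (λ x → h x es) xs)) m r es ≡ sum (map (λ x → total (h x) m r es) xs)
  total-sum h xs zero    r es with accepting r
  ... | true  = refl
  ... | false = sym (sum-0 xs)
  total-sum h xs (suc m) r es = trans
    (sum-cong (λ e → total-sum h xs m (target e) (e ∷ es)) (edges r))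
    (sum-swap (λ e x → total (h x) m (target e) (e ∷ es)) (edges r) xs)

  -- Polynomial bound on the running time

  rank : Residue → ℕ
  rank r = sum (tabulate (residual r))

  rank-lower : ∀ d r → residual r d ≢ 0 → rank r ≡ suc (rank (lower d r))
  rank-lower d r neq = sum-tabulate-suc (residual r) (residual (lower d r)) d
    (trans (sym (suc-pred (residual r d) {{≢-nonZero neq}})) (cong suc (sym (residual-lower-≡ d r))))
    (λ i i≢d → sym (residual-lower-≢ d r i i≢d))

  width : ℕ → ℕ
  width m = suc (suc k * m)

  module _ {T A : ℕ} (T≤A : T ≤ A) (2+k≤A : 2 + k ≤ A) where

    A≤A*width^ : ∀ m j → A ≤ A * width m ^ j
    A≤A*width^ m j = m≤m*n A (width m ^ j) {{m^n≢0 (width m) j}}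

    time-nothing : ∀ m → time T m nothing ≤ A
    time-nothing zero    = T≤A
    time-nothing (suc m) = ≤-trans (s≤s z≤n) 2+k≤A

    -- Of the children of a node of rank j, the free one keeps the rank and the
    -- other k have smaller rank; width grows by suc k, which pays for them.
    time-≤ : ∀ m j r → rank r ≤ j → time T m (just r) ≤ A * width m ^ suc j
    time-≤ zero    j r _      = ≤-trans T≤A (A≤A*width^ 0 (suc j))
    time-≤ (suc m) j r rank≤j = begin
      suc (sum (map (λ e → suc (time T m (target e))) (edges (just r))))
        ≡⟨ cong suc (sum-edges (λ e → suc (time T m (target e))) r) ⟩
      2 + time T m (just r) + sum (tabulate λ d → suc (time T m (lowered d r)))
        ≤⟨ +-mono-≤ (s≤s (s≤s (time-≤ m j r rank≤j)))
             (sum-tabulate-≤ _ _ λ d → s≤s (time-lowered d j rank≤j)) ⟩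
      2 + A * width m ^ suc j + k * suc (A * width m ^ j)
        ≡⟨ collect A k (width m) (width m ^ j) ⟩
      2 + k + (width m + k) * (A * width m ^ j)
        -- The `2 + k` steps spent at the node itself (one per child, one to leave) are absorbed as
        -- one more copy of `A * width m ^ j`; hence `width` grows by `suc k` and not by `k`.
        ≤⟨ +-monoˡ-≤ _ (≤-trans 2+k≤A (A≤A*width^ m j)) ⟩
      A * width m ^ j + (width m + k) * (A * width m ^ j)
        ≡⟨ factor A k (width m) (width m ^ j) ⟩
      A * ((width m + suc k) * width m ^ j)
        ≤⟨ *-monoʳ-≤ A (*-monoʳ-≤ (width m + suc k) (^-monoˡ-≤ j (m≤m+n (width m) (suc k)))) ⟩
      A * (width m + suc k) ^ suc j
        ≡⟨ cong (λ x → A * x ^ suc j) (width-suc k m) ⟩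
      A * width (suc m) ^ suc j ∎
      where
      open ≤-Reasoning
      collect : ∀ a k x y → 2 + a * (x * y) + k * suc (a * y) ≡ 2 + k + (x + k) * (a * y)
      collect = solve-∀
      factor : ∀ a k x y → a * y + (x + k) * (a * y) ≡ a * ((x + suc k) * y)
      factor = solve-∀
      width-suc : ∀ k m → suc (suc k * m) + suc k ≡ suc (suc k * suc m)
      width-suc = solve-∀

      time-lowered : ∀ d j → rank r ≤ j → time T m (lowered d r) ≤ A * width m ^ j
      time-lowered d j rank≤j with residual r d ≟ 0
      ... | yes eq rewrite dec-true (residual r d ≟ 0) eq =
        ≤-trans (time-nothing m) (A≤A*width^ m j)
      -- The rank of `r` is a successor here, so `j` is one too, and the smaller rank of `lower d r`
      -- saves one factor of the width.
      ... | no neq rewrite dec-false (residual r d ≟ 0) neq | rank-lower d r neq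
        with s≤s rank≤j′ ← rank≤j =
        time-≤ m _ (lower d r) rank≤j′

  -- One factor ℓ comes from the cost of a leaf, `suc (rank full)` factors from the tree. Bounding
  -- `n` and 1 by ℓ turns the cost of a leaf plus `2 + k` into `(5 * k + 18) * ℓ` and `width n` into
  -- `(k + 2) * ℓ`; the outer `suc` pays for finding the end of the unary block.
  degree coefficient : ℕ
  degree      = 2 + rank full
  coefficient = suc ((5 * k + 18) * (k + 2) ^ suc (rank full))

  running-time : ∀ n u → let ℓ = n + suc u in
    suc n + time (leafTime ℓ n (suc (k * n))) n (just full) ≤ coefficient * ℓ ^ degree + coefficient
  running-time n u = begin
    suc n + time T n (just full)
      ≤⟨ +-mono-≤ n<ℓ^ (time-≤ (m≤m+n T (2 + k)) (m≤n+m (2 + k) T) n (rank full) full ≤-refl) ⟩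
    ℓ ^ degree + (T + (2 + k)) * width n ^ suc (rank full)
      ≤⟨ +-monoʳ-≤ (ℓ ^ degree) (*-mono-≤ leaf≤ (^-monoˡ-≤ (suc (rank full)) width≤)) ⟩
    ℓ ^ degree + (5 * k + 18) * ℓ * ((k + 2) * ℓ) ^ suc (rank full)
      ≡⟨ cong (λ x → ℓ ^ degree + (5 * k + 18) * ℓ * x) (^-distribʳ-* (suc (rank full)) (k + 2) ℓ) ⟩
    ℓ ^ degree + (5 * k + 18) * ℓ * ((k + 2) ^ suc (rank full) * ℓ ^ suc (rank full))
      ≡⟨ regroup ℓ (ℓ ^ suc (rank full)) (5 * k + 18) ((k + 2) ^ suc (rank full)) ⟩
    coefficient * ℓ ^ degree
      ≤⟨ m≤m+n _ coefficient ⟩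
    coefficient * ℓ ^ degree + coefficient ∎
    where
    open ≤-Reasoning
    ℓ T : ℕ
    ℓ = n + suc u
    T = leafTime ℓ n (suc (k * n))

    n<ℓ^ : suc n ≤ ℓ ^ degree
    n<ℓ^ = begin
      suc n          ≤⟨ m≤m+n (suc n) u ⟩
      suc n + u      ≡⟨ +-suc n u ⟨
      ℓ              ≡⟨ *-identityʳ ℓ ⟨
      ℓ ^ 1          ≤⟨ ^-monoʳ-≤ ℓ {1} {degree} (s≤s z≤n) ⟩
      ℓ ^ degree     ∎
      where
      instance
        ℓ≢0 : NonZero ℓ
        ℓ≢0 = >-nonZero (≤-trans (s≤s z≤n) (m≤n+m (suc u) n))

    leaf-slack : ∀ k n u →
      1 + (n + suc u + (1 + (n + suc u + (1 + (n * (k + 1) + (1 + (n + (1 + ((n + suc u + n * k) + 1)))))))))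
        + (1 + (suc (k * n) + (1 + (suc (k * n) + 1)))) + (2 + k)
        + (k * n + 4 * k + 5 * k * u + 13 * n + 2 + 15 * u)
      ≡ (5 * k + 18) * (n + suc u)
    leaf-slack = solve-∀

    width-slack : ∀ k n u → suc (suc k * n) + (n + k + 1 + (k + 2) * u) ≡ (k + 2) * (n + suc u)
    width-slack = solve-∀

    leaf≤ : T + (2 + k) ≤ (5 * k + 18) * ℓ
    leaf≤ = m+n≤o⇒m≤o (T + (2 + k)) (≤-reflexive (leaf-slack k n u))

    width≤ : width n ≤ (k + 2) * ℓ
    width≤ = m+n≤o⇒m≤o (width n) (≤-reflexive (width-slack k n u))

    ^-distribʳ-* : ∀ e a b → (a * b) ^ e ≡ a ^ e * b ^ e
    ^-distribʳ-* zero    a b = refl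
    ^-distribʳ-* (suc e) a b rewrite ^-distribʳ-* e a b = interchange a b (a ^ e) (b ^ e)
      where
      interchange : ∀ a b c d → a * b * (c * d) ≡ a * c * (b * d)
      interchange = solve-∀

    regroup : ∀ x y a b → x * y + a * x * (b * y) ≡ suc (a * b) * (x * y)
    regroup = solve-∀

  -- Leaves as list instances

  respects-∷ : ∀ {n} l x (L : Vec (Subset k) n) σ →
    Respects (l ∷ L) (x ∷ σ) ⇔ (x ∈ l × Respects L σ)
  respects-∷ l x L σ = mk⇔ (λ r → r zero , r ∘ suc)
    (λ { (x∈l , r) zero → x∈l ; (x∈l , r) (suc v) → r v })

  respects-fits : ∀ es (σ : Vec (Fin k) (length es)) →
    𝟙 (respects? (Vec.map label (Vec.fromList es)) σ) ≡ fits (toList σ) es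
  respects-fits []       []      = refl
  respects-fits (e ∷ es) (x ∷ σ) =
    trans (𝟙-⇔ (respects-∷ (label e) x L σ) (respects? (label e ∷ L) (x ∷ σ))
        (x ∈? label e ×-dec respects? L σ))
      (trans (𝟙-× (x ∈? label e) (respects? L σ)) (cong (𝟙 (x ∈? label e) *_) (respects-fits es σ)))
    where
    L : Vec (Subset k) (length es)
    L = Vec.map label (Vec.fromList es)

  lists : ∀ es {n} → length es ≡ n → ∃[ L ]
    flatten {n} L ≡ word es × (∀ σ → 𝟙 (respects? L σ) ≡ fits (toList σ) es)
  lists es refl = Vec.map label (Vec.fromList es) , flatten-labels es , respects-fits es
    where
    flatten-labels : ∀ es → flatten (Vec.map label (Vec.fromList es)) ≡ word es
    flatten-labels []       = refl
    flatten-labels (e ∷ es) =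
      trans (toList-++ (label e) _) (cong (toList (label e) ++_) (flatten-labels es))

  occurs-satisfies : ∀ {n} (σ : Vec (Fin k) n) →
    Occurs (residual full) (reverse (toList σ)) ⇔ Satisfies C σ
  occurs-satisfies σ = mk⇔ (λ occ d → subst₂ _≤_ (residual-full d) (same-count d) (occ d))
    (λ sat d → subst₂ _≤_ (sym (residual-full d)) (sym (same-count d)) (sat d))
    where
    same-count : ∀ d → occurrences d (reverse (toList σ)) ≡ Vec.count (_≟ᶠ d) σ
    same-count d = trans (occurrences-ʳ++ d (toList σ) [])
      (trans (+-identityʳ _) (sym (count-occurrences d σ)))

  total-satisfies : ∀ {n} (σ : Vec (Fin k) n) →
    total (fits (toList σ)) n (just full) [] ≡ 𝟙 (satisfies? C σ)
  total-satisfies {n} σ = begin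
    total (fits (toList σ)) n (just full) []
      -- The search meets the vertices from last to first, so the unread part at the root is the
      -- reversal of σ.
      ≡⟨ cong₂ (λ ρ m → total (fits ρ) m (just full) []) (List.reverse-involutive (toList σ))
           (trans (List.length-reverse (toList σ)) (Vec.length-toList σ)) ⟨
    total (fits (reverse τ)) (length τ) (just full) []
      ≡⟨ total-fits τ [] full [] ⟩
    𝟙 (occurs? (residual full) τ) * 1
      ≡⟨ *-identityʳ _ ⟩
    𝟙 (occurs? (residual full) τ)
      ≡⟨ 𝟙-⇔ (occurs-satisfies σ) (occurs? (residual full) τ) (satisfies? C σ) ⟩
    𝟙 (satisfies? C σ) ∎
    where
    open ≡-Reasoning
    τ : List (Fin k)
    τ = reverse (toList σ)

-- Number of digits of the count, and the reduction

length-cartesianProductWith : ∀ {A B C : Set} (f : A → B → C) xs ys →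
  length (List.cartesianProductWith f xs ys) ≡ length xs * length ys
length-cartesianProductWith f []       ys = refl
length-cartesianProductWith f (x ∷ xs) ys = trans (List.length-++ (map (f x) ys))
  (cong₂ _+_ (List.length-map (f x) ys) (length-cartesianProductWith f xs ys))

length-assignments : ∀ k n → length (assignments k n) ≡ k ^ n
length-assignments k zero    = refl
length-assignments k (suc n) = trans
  (length-cartesianProductWith Vec._∷_ (List.allFin k) (assignments k n))
  (cong₂ _*_ (List.length-tabulate {n = k} id) (length-assignments k n))

n<2^n : ∀ n → n < 2 ^ n
n<2^n zero    = s≤s z≤n
n<2^n (suc n) = +-mono-≤ (m^n>0 2 n) (≤-trans (n<2^n n) (m≤m+n (2 ^ n) 0))

-- Gives the number of digits that the accumulator may need. The extra digit makes the bound strict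
-- even for `n = 0`, where the count can be 1.
k^n<2^ : ∀ k n → k ^ n < 2 ^ suc (k * n)
k^n<2^ k n = begin-strict
  k ^ n             ≤⟨ ^-monoˡ-≤ n (<⇒≤ (n<2^n k)) ⟩
  (2 ^ k) ^ n       ≡⟨ ^-*-assoc 2 k n ⟩
  2 ^ (k * n)       <⟨ ^-monoʳ-< 2 (s≤s (s≤s z≤n)) (n<1+n (k * n)) ⟩
  2 ^ suc (k * n)   ∎
  where open ≤-Reasoning

proposition28 : ∀ (k : ℕ) (M : Matrix k) → SymmetricMatrix M → (C : Fin k → ℕ) →
    # C - M -partitions ≤ᵀ #List- M -partitions
proposition28 k M _ C = machine , coefficient , degree , reduction
  where
  open Requirements C

  reduction : ∀ oracle → oracle IsOracleFor #List- M -partitions → ∀ G →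
    let open Run machine oracle in
    ∃[ t ] t ≤ coefficient * length (encodeGraph G) ^ degree + coefficient
         × initial (encodeGraph G) ⇓⟨ t ⟩ binary (CountingProblem.value (# C - M -partitions) G)
  reduction oracle isOracle G = t , t≤poly , subst (λ x → _ ⇓⟨ t ⟩ binary x) total≡value computed
    where
    open Correctness oracle

    n value : ℕ
    n = Graph.order G
    value = CountingProblem.value (# C - M -partitions) G

    v : Word
    v = flatten (Graph.adjacency G)

    partitions : List (Vec (Fin k) n)
    partitions = filter (isPartition? M G) (assignments k n)

    f : List Edge → ℕ
    f es = sum (map (λ σ → fits (toList σ) es) partitions)

    -- The graph is encoded before the lists, so the input followed by the word of the stack is
    -- literally the encoding of an instance.
    answers : ∀ es → length es ≡ n → oracle (encodeGraph G ++ word es) ≡ binary (f es)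
    answers es len with L , flat , respects ← lists es len = begin
      oracle (encodeGraph G ++ word es)
        ≡⟨ cong (λ u → oracle (encodeGraph G ++ u)) flat ⟨
      oracle (encodeGraph G ++ flatten L)
        ≡⟨ isOracle (G , L) ⟩
      binary (numberOf (λ σ → isPartition? M G σ ×-dec respects? L σ))
        ≡⟨ cong binary (length-filter-× (isPartition? M G) (respects? L) (assignments k n)) ⟩
      binary (sum (map (λ σ → 𝟙 (respects? L σ)) partitions))
        ≡⟨ cong binary (sum-cong respects partitions) ⟩
      binary (f es) ∎
      where open ≡-Reasoning

    total≡value : total f n (just full) [] ≡ value
    total≡value = begin
      total f n (just full) []
        ≡⟨ total-sum (λ σ → fits (toList σ)) partitions n (just full) [] ⟩
      sum (map (λ σ → total (fits (toList σ)) n (just full) []) partitions)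
        ≡⟨ sum-cong total-satisfies partitions ⟩
      sum (map (λ σ → 𝟙 (satisfies? C σ)) partitions)
        ≡⟨ length-filter-× (isPartition? M G) (satisfies? C) (assignments k n) ⟨
      value ∎
      where open ≡-Reasoning

    value≤k^n : value ≤ k ^ n
    value≤k^n = ≤-trans (List.length-filter _ (assignments k n)) (≤-reflexive (length-assignments k n))

    short : ∀ x → x ≤ value → length (binary x) ≤ suc (k * n)
    short x x≤ = length-binary (suc (k * n)) x (≤-<-trans (≤-trans x≤ value≤k^n) (k^n<2^ k n))

    run : ∃[ t ] t ≤ suc n + time (leafTime (length (encodeGraph G)) n (suc (k * n))) n (just full)
      × initial (encodeGraph G) ⇓⟨ t ⟩ binary (total f n (just full) [])
    -- The accumulator never exceeds its final value, so `value` itself serves as the bound `X`.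
    run = computes n v (suc (k * n)) value f answers short (≤-reflexive total≡value)

    t : ℕ
    t = proj₁ run

    computed : initial (encodeGraph G) ⇓⟨ t ⟩ binary (total f n (just full) [])
    computed = proj₂ (proj₂ run)

    length-input : length (encodeGraph G) ≡ n + suc (length v)
    length-input = trans (List.length-++ (replicate n true))
      (cong (_+ suc (length v)) (List.length-replicate n))

    t≤poly : t ≤ coefficient * length (encodeGraph G) ^ degree + coefficient
    t≤poly = ≤-trans (proj₁ (proj₂ run))
      (subst (λ ℓ → suc n + time (leafTime ℓ n (suc (k * n))) n (just full) ≤
          coefficient * ℓ ^ degree + coefficient)
        (sym length-input) (running-time n (length v)))
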